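{- Let $\Sigma$ be a circuit signature with an interpretation $\mathcal I$. Observational equivalence $\sim_{\mathcal I}$ is the largest adequate congruence on $\mathbf{SCirc}_\Sigma$: it is a congruence (preserved by composition, tensor and trace), it is adequate (it only relates circuits with the same denotation $[\![-]\!]^{\mathbf S}_{\mathcal I}$), and it is the largest such relation.
   Context: CIRCUITS. A circuit signature $\Sigma=(V,\bullet,P,\mathrm{dom},\mathrm{cod})$ consists of a finite set $V$ of values, an element $\bullet\in V$, a set $P$ of primitive symbols and functions $\mathrm{dom},\mathrm{cod}:P\to\mathbb N$. A PROP is a strict symmetric monoidal category with objects the natural numbers and tensor on objects given by addition. $\mathbf{CCirc}_\Sigma$ (combinational circuits) is the PROP freely generated by $p:\mathrm{dom}(p)\to\mathrm{cod}(p)$ ($p\in P$), $\bullet:0\to1$, fork $1\to2$, join $2\to1$, stub $1\to0$. $\mathbf{SCirc}_\Sigma$ (sequential circuits) is the symmetric traced PROP freely generated by the same generators together with $v:0\to1$ for each $v\in V\setminus\{\bullet\}$ and a delay $\delta:1\to1$. Combinational circuits are regarded as sequential ones. Composition in diagrammatic order is written $;$, and the trace is $\mathrm{Tr}^x:\mathrm{Hom}(x+m,x+n)\to\mathrm{Hom}(m,n)$. Multi-wire versions $\bullet_n:0\to n$, $\mathrm{fork}_n:n\to 2n$, $\mathrm{join}_n:2n\to n$, $\mathrm{stub}_n:n\to0$, $\delta_n:n\to n$ act wirewise, and a word $\bar v\in V^n$ gives a circuit $\bar v:0\to n$ (tensor of its values, the value $\bullet$ being the generator $\bullet$). For $\bar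 v\in V^n$ the register is $\mathrm{reg}_{\bar v}:=(\bar v\otimes\delta_n);\mathrm{join}_n:n\to n$. INTERPRETATION AND DENOTATION. An interpretation $\mathcal I=(\sqsubseteq,[\![-]\!])$ of $\Sigma$ is a lattice order $\sqsubseteq$ on $V$ with least element $\bot=\bullet$ and, for each $p\in P$, a monotone function $[\![p]\!]:V^{\mathrm{dom}(p)}\to V^{\mathrm{cod}(p)}$ preserving the all-$\bot$ tuple. $(V^m)^\omega$ is the set of streams (functions $\mathbb N\to V^m$), ordered pointwise. The denotation $[\![F]\!]^{\mathbf S}_{\mathcal I}:(V^m)^\omega\to(V^n)^\omega$ of $F:m\to n$ in $\mathbf{SCirc}_\Sigma$ is defined compositionally: $p$ acts as $[\![p]\!]$ at each time index; fork is $v\mapsto(v,v)$, join is $(v,w)\mapsto v\sqcup w$, stub is $v\mapsto()$, each at every time index; $\bullet$ is the constant stream $\bot$; $v$ is the stream $v,\bot,\bot,\dots$; $\delta$ sends $\sigma$ to $\bot,\sigma(0),\sigma(1),\dots$; composition is function composition, tensor is product, and $\mathrm{Tr}^x(f)(\sigma)=\pi_1(f(\mu,\sigma))$ with $\mu$ the least fixed point of $\tau\mapsto\pi_0(f(\tau,\sigma))$. REDUCTIONS. Reductions $\rightsquigarrow$ are rewrite rules on sequential circuits, applied modulo the axioms of symmetric traced monoidal categories; $\rightsquigarrow^*$ denotes a sequence of reductions. (Mealy): for combinational $C:x+y+z+m\to x+y+n$ and $\bar u\in V^z$, $\mathrm{Tr}^{x+y}((\mathrm{id}_x\otimes\delta_y\otimes\bar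 u\otimes\mathrm{id}_m);C)\rightsquigarrow\mathrm{Tr}^{x+y+z}((\mathrm{id}_x\otimes\mathrm{reg}_{\bot^y\bar u}\otimes\mathrm{id}_m);C;(\mathrm{id}_{x+y}\otimes\bullet_z\otimes\mathrm{id}_n))$. (IF): for combinational $C:x+m\to x+n$, $\mathrm{Tr}^x(C)\rightsquigarrow C^{(d)};(\mathrm{stub}_x\otimes\mathrm{id}_n)$, where $d$ is the length of the longest chain in $V^x$, $C^{(0)}=(\bullet_x\otimes\mathrm{id}_m);C$, $C^{(i+1)}=\mathrm{fork}_m;((C^{(i)};(\mathrm{id}_x\otimes\mathrm{stub}_n))\otimes\mathrm{id}_m);C$. (Str): for combinational $C:a\to b$ and $\bar u\in V^a$, $\mathrm{reg}_{\bar u};C\rightsquigarrow((\bar u;C)\otimes(C;\delta_b));\mathrm{join}_b$. Value rules: $v;\mathrm{fork}\rightsquigarrow v\otimes v$; $(v\otimes w);\mathrm{join}\rightsquigarrow v\sqcup w$; $v;\mathrm{stub}\rightsquigarrow\mathrm{id}_0$; $\bar v;p\rightsquigarrow[\![p]\!](\bar v)$. PRODUCTIVITY. For every $F:m\to n$ and $\bar v\in V^m$ there are $\bar w\in V^n$ and $F':m\to n$ with $\mathrm{reg}_{\bar v};F\rightsquigarrow^*F';\mathrm{reg}_{\bar w}$, by applying (Mealy), (IF), (Str) once each in succession and then the value rules exhaustively. The output waveform of $F$ on an input waveform $\bar v_1\cdots\bar v_k$ ($\bar v_i\in V^m$) is the word $\bar w_1\cdots\bar w_k$ over $V^n$ obtained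 by iterating this: $F_0=F$ and $\mathrm{reg}_{\bar v_i};F_{i-1}\rightsquigarrow^*F_i;\mathrm{reg}_{\bar w_i}$. OBSERVATIONAL EQUIVALENCE. Two sequential circuits $F,G:m\to n$ with no more than $c$ delays (delay generators) are observationally equivalent under $\mathcal I$, written $F\sim_{\mathcal I}G$, if applying productivity produces the same output waveforms for all input waveforms in $(V^m)^\star$ of length $|V^c|+1=|V|^c+1$.
   Formalization: Observational equivalence here requires equal output waveforms for every c bounding both delay counts, not for a single c; with one finite test of length |V|^c+1 adequacy fails (one-delay loops of periods 8 and 7 over a 10-element lattice can agree for 13 > 11 ticks, then differ). -}

module Defs where

open import Level using (Level; 0ℓ) renaming (suc to lsuc)
open import Data.Nat.Base using (ℕ; zero; suc; _+_; _∸_; _^_; _≤_; _<_; z≤n; s≤s)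
import Data.Nat.Properties as ℕ
open import Data.Fin.Base as Fin using (Fin; inject₁; toℕ; fromℕ<; funToFin; finToFun)
import Data.Fin.Properties as Fin
open import Data.Vec.Base using (Vec; []; _∷_; _++_; take; drop; replicate; lookup; tabulate)
open import Data.Vec.Properties using (tabulate∘lookup; tabulate-cong; take++drop≡id)
open import Data.Vec.Relation.Binary.Pointwise.Inductive as Pointwise using (Pointwise; []; _∷_)
open import Data.Product.Base using (Σ; ∃-syntax; _×_; _,_; proj₁; proj₂)
open import Function.Base using (_∘_)
open import Function.Bundles using (_↔_; _⇔_; module Inverse)
open import Function.Properties.Inverse using (Inverse⇒Injection)
open import Relation.Nullary.Decidable.Core using (yes; no)
open import Relation.Nullary.Decidable using (via-injection)
open import Relation.Binary.Core using (Rel)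
open import Relation.Binary.Definitions using (DecidableEquality; Minimum)
open import Relation.Binary.Structures using (IsEquivalence)
open import Relation.Binary.Lattice.Structures using (IsLattice)
import Relation.Binary.Construct.NonStrictToStrict as ToStrict
open import Relation.Binary.Construct.Closure.ReflexiveTransitive using (Star)
open import Relation.Binary.PropositionalEquality
  using (_≡_; _≢_; _≗_; refl; sym; trans; cong; cong₂; subst; subst₂; module ≡-Reasoning)

record Signature : Set₁ where
  field
    V       : Set
    ∣V∣     : ℕ
    finite  : V ↔ Fin ∣V∣
    ∙       : V
    P       : Set
    dom cod : P → ℕ

  infix 4 _≟_
  _≟_ : DecidableEquality V
  _≟_ = via-injection (Inverse⇒Injection finite) Fin._≟_

module Circuits (S : Signature) where
  open Signature S

  infixl 5 _⨾_
  infixr 6 _⊗_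

  data CGen : ℕ → ℕ → Set where
    prim : (p : P) → CGen (dom p) (cod p)
    bot  : CGen 0 1
    fork : CGen 1 2
    join : CGen 2 1
    stub : CGen 1 0

  data SGen : ℕ → ℕ → Set where
    comb  : ∀ {m n} → CGen m n → SGen m n
    val   : (v : V) → .(v ≢ ∙) → SGen 0 1
    delay : SGen 1 1

  -- Terms representing the morphisms of CCirc.  They are only ever used through
  -- their image ⌈_⌉ in SCirc, where they are compared by _≈_.
  data CCirc : ℕ → ℕ → Set where
    gen : ∀ {m n} → CGen m n → CCirc m n
    id  : ∀ n → CCirc n n
    _⨾_ : ∀ {m n k} → CCirc m n → CCirc n k → CCirc m k
    _⊗_ : ∀ {m n m′ n′} → CCirc m n → CCirc m′ n′ → CCirc (m + m′) (n + n′)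
    swap   : ∀ m n → CCirc (m + n) (n + m)

  -- Terms representing the morphisms of SCirc, which are the classes of _≈_.
  data SCirc : ℕ → ℕ → Set where
    gen : ∀ {m n} → SGen m n → SCirc m n
    id  : ∀ n → SCirc n n
    _⨾_ : ∀ {m n k} → SCirc m n → SCirc n k → SCirc m k
    _⊗_ : ∀ {m n m′ n′} → SCirc m n → SCirc m′ n′ → SCirc (m + m′) (n + n′)
    swap   : ∀ m n → SCirc (m + n) (n + m)
    Tr  : ∀ x {m n} → SCirc (x + m) (x + n) → SCirc m n

  ⌈_⌉ : ∀ {m n} → CCirc m n → SCirc m n
  ⌈ gen g ⌉ = gen (comb g)
  ⌈ id n ⌉  = id n
  ⌈ C ⨾ D ⌉ = ⌈ C ⌉ ⨾ ⌈ D ⌉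
  ⌈ C ⊗ D ⌉ = ⌈ C ⌉ ⊗ ⌈ D ⌉
  ⌈ swap m n ⌉ = swap m n

  castᶜ : ∀ {m n m′ n′} → m ≡ m′ → n ≡ n′ → CCirc m n → CCirc m′ n′
  castᶜ = subst₂ CCirc

  cast : ∀ {m n m′ n′} → m ≡ m′ → n ≡ n′ → SCirc m n → SCirc m′ n′
  cast = subst₂ SCirc

  infix 4 _≈_

  -- The congruence generated by the axioms of strict symmetric traced monoidal
  -- categories.  Strictness equates terms such as (F ⊗ G) ⊗ H and F ⊗ (G ⊗ H),
  -- whose boundaries are equal but not definitionally so; hence the relation is
  -- heterogeneous.  Related terms always have propositionally equal boundaries.
  data _≈_ : ∀ {m n m′ n′} → SCirc m n → SCirc m′ n′ → Set where
    ≈-refl  : ∀ {m n} {F : SCirc m n} → F ≈ F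
    ≈-sym   : ∀ {m n m′ n′} {F : SCirc m n} {G : SCirc m′ n′} → F ≈ G → G ≈ F
    ≈-trans : ∀ {m n m′ n′ m″ n″}
              {F : SCirc m n} {G : SCirc m′ n′} {H : SCirc m″ n″} →
              F ≈ G → G ≈ H → F ≈ H
    ⨾-cong  : ∀ {m n k m′ n′ k′} {F : SCirc m n} {G : SCirc n k}
              {F′ : SCirc m′ n′} {G′ : SCirc n′ k′} →
              F ≈ F′ → G ≈ G′ → F ⨾ G ≈ F′ ⨾ G′
    ⊗-cong  : ∀ {m n k l m′ n′ k′ l′} {F : SCirc m n} {G : SCirc k l}
              {F′ : SCirc m′ n′} {G′ : SCirc k′ l′} →
              F ≈ F′ → G ≈ G′ → F ⊗ G ≈ F′ ⊗ G′
    Tr-cong : ∀ {x m n m′ n′}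
              {F : SCirc (x + m) (x + n)} {F′ : SCirc (x + m′) (x + n′)} →
              F ≈ F′ → Tr x F ≈ Tr x F′

    -- category
    ⨾-identityˡ : ∀ {m n} {F : SCirc m n} → id m ⨾ F ≈ F
    ⨾-identityʳ : ∀ {m n} {F : SCirc m n} → F ⨾ id n ≈ F
    ⨾-assoc     : ∀ {m n k l} {F : SCirc m n} {G : SCirc n k} {H : SCirc k l} →
                  (F ⨾ G) ⨾ H ≈ F ⨾ (G ⨾ H)

    -- strict monoidal
    ⊗-id        : ∀ {m n} → id m ⊗ id n ≈ id (m + n)
    interchange : ∀ {m n k m′ n′ k′} {F : SCirc m n} {G : SCirc n k}
                  {F′ : SCirc m′ n′} {G′ : SCirc n′ k′} →
                  (F ⨾ G) ⊗ (F′ ⨾ G′) ≈ (F ⊗ F′) ⨾ (G ⊗ G′)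
    ⊗-identityˡ : ∀ {m n} {F : SCirc m n} → id 0 ⊗ F ≈ F
    ⊗-identityʳ : ∀ {m n} {F : SCirc m n} → F ⊗ id 0 ≈ F
    ⊗-assoc     : ∀ {m n k l i j} {F : SCirc m n} {G : SCirc k l} {H : SCirc i j} →
                  (F ⊗ G) ⊗ H ≈ F ⊗ (G ⊗ H)

    -- symmetry
    swap-natural    : ∀ {m n m′ n′} {F : SCirc m n} {G : SCirc m′ n′} →
                      (F ⊗ G) ⨾ swap n n′ ≈ swap m m′ ⨾ (G ⊗ F)
    swap-involutive : ∀ {m n} → swap m n ⨾ swap n m ≈ id (m + n)
    swap-hexagon    : ∀ {m n k} →
                      swap m (n + k) ≈
                      cast (ℕ.+-assoc m n k) (ℕ.+-assoc n m k) (swap m n ⊗ id k)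
                        ⨾ cast refl (sym (ℕ.+-assoc n k m)) (id n ⊗ swap m k)

    -- trace
    tightening  : ∀ {x m n m′ n′} {F : SCirc m′ m} {G : SCirc (x + m) (x + n)}
                  {H : SCirc n n′} →
                  Tr x ((id x ⊗ F) ⨾ G ⨾ (id x ⊗ H)) ≈ F ⨾ Tr x G ⨾ H
    sliding     : ∀ {x y m n} {F : SCirc (x + m) (y + n)} {H : SCirc y x} →
                  Tr x (F ⨾ (H ⊗ id n)) ≈ Tr y ((H ⊗ id m) ⨾ F)
    vanishing₀  : ∀ {m n} {F : SCirc m n} → Tr 0 F ≈ F
    vanishing₊  : ∀ {x y m n} {F : SCirc ((x + y) + m) ((x + y) + n)} →
                  Tr (x + y) F ≈
                  Tr y (Tr x (cast (ℕ.+-assoc x y m) (ℕ.+-assoc x y n) F))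
    superposing : ∀ {x m n k l} {F : SCirc (x + m) (x + n)} {G : SCirc k l} →
                  Tr x F ⊗ G ≈
                  Tr x (cast (ℕ.+-assoc x m k) (ℕ.+-assoc x n l) (F ⊗ G))
    yanking     : ∀ {x} → Tr x (swap x x) ≈ id x

  bots : ∀ n → CCirc 0 n
  bots zero    = id 0
  bots (suc n) = gen bot ⊗ bots n

  stubs : ∀ n → CCirc n 0
  stubs zero    = id 0
  stubs (suc n) = gen stub ⊗ stubs n

  -- forks n and joins n pair wire i of one copy of n with wire i of the other.
  forks : ∀ n → CCirc n (n + n)
  forks zero    = id 0
  forks (suc n) = (gen fork ⊗ forks n)
                    ⨾ castᶜ refl (cong suc (ℕ.+-assoc n 1 n)) (id 1 ⊗ (swap 1 n ⊗ id n))

  joins : ∀ n → CCirc (n + n) n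
  joins zero    = id 0
  joins (suc n) = castᶜ (cong suc (ℕ.+-assoc n 1 n)) refl (id 1 ⊗ (swap n 1 ⊗ id n))
                    ⨾ (gen join ⊗ joins n)

  delays : ∀ n → SCirc n n
  delays zero    = id 0
  delays (suc n) = gen delay ⊗ delays n

  value : V → SCirc 0 1
  value v with v ≟ ∙
  ... | yes _  = gen (comb bot)
  ... | no v≢∙ = gen (val v v≢∙)

  word : ∀ {n} → Vec V n → SCirc 0 n
  word []       = id 0
  word (v ∷ vs) = value v ⊗ word vs

  reg : ∀ {n} → Vec V n → SCirc n n
  reg {n} vs = (word vs ⊗ delays n) ⨾ ⌈ joins n ⌉

  #delays : ∀ {m n} → SCirc m n → ℕ
  #delays (gen (comb _))  = 0
  #delays (gen (val _ _)) = 0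
  #delays (gen delay)     = 1
  #delays (id _)          = 0
  #delays (F ⨾ G)         = #delays F + #delays G
  #delays (F ⊗ G)         = #delays F + #delays G
  #delays (swap _ _)      = 0
  #delays (Tr _ F)        = #delays F

  CircRel : (ℓ : Level) → Set (lsuc ℓ)
  CircRel ℓ = ∀ {m n} → Rel (SCirc m n) ℓ

  -- A relation on the morphisms of SCirc is a relation on terms that respects _≈_;
  -- for an equivalence relation this amounts to containing _≈_.
  record IsCongruence {ℓ} (R : CircRel ℓ) : Set ℓ where
    field
      isEquivalence : ∀ {m n} → IsEquivalence (R {m} {n})
      ≈⇒R           : ∀ {m n} {F G : SCirc m n} → F ≈ G → R F G
      ⨾-preserves   : ∀ {m n k} {F F′ : SCirc m n} {G G′ : SCirc n k} →
                      R F F′ → R G G′ → R (F ⨾ G) (F′ ⨾ G′)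
      ⊗-preserves   : ∀ {m n k l} {F F′ : SCirc m n} {G G′ : SCirc k l} →
                      R F F′ → R G G′ → R (F ⊗ G) (F′ ⊗ G′)
      Tr-preserves  : ∀ x {m n} {F F′ : SCirc (x + m) (x + n)} →
                      R F F′ → R (Tr x F) (Tr x F′)

record Interpretation (S : Signature) : Set₁ where
  open Signature S
  infix 4 _⊑_
  field
    _⊑_       : Rel V 0ℓ
    _⊔_ _⊓_   : V → V → V
    isLattice : IsLattice _≡_ _⊑_ _⊔_ _⊓_
    ∙-minimum : Minimum _⊑_ ∙
    ⟦_⟧ᵖ      : (p : P) → Vec V (dom p) → Vec V (cod p)
    monotone  : ∀ p {us vs} → Pointwise _⊑_ us vs → Pointwise _⊑_ (⟦ p ⟧ᵖ us) (⟦ p ⟧ᵖ vs)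
    strict    : ∀ p → ⟦ p ⟧ᵖ (replicate (dom p) ∙) ≡ replicate (cod p) ∙

module Denotation {S : Signature} (I : Interpretation S) where
  open Signature S
  open Interpretation I
  open Circuits S
  private module L = IsLattice isLattice

  infix 4 _⊑*_ _⊑ˢ_ _⊑[_]_

  _⊑*_ : ∀ {n} → Rel (Vec V n) 0ℓ
  _⊑*_ = Pointwise _⊑_

  ⊥* : ∀ {n} → Vec V n
  ⊥* = replicate _ ∙

  ⊑*-reflexive : ∀ {n} {us vs : Vec V n} → us ≡ vs → us ⊑* vs
  ⊑*-reflexive refl = Pointwise.refl L.refl

  ⊑*-trans : ∀ {n} {us vs ws : Vec V n} → us ⊑* vs → vs ⊑* ws → us ⊑* ws
  ⊑*-trans = Pointwise.trans L.trans

  ⊑*-antisym : ∀ {n} {us vs : Vec V n} → us ⊑* vs → vs ⊑* us → us ≡ vs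
  ⊑*-antisym []       []       = refl
  ⊑*-antisym (p ∷ ps) (q ∷ qs) = cong₂ _∷_ (L.antisym p q) (⊑*-antisym ps qs)

  ⊥*-minimum : ∀ {n} (vs : Vec V n) → ⊥* ⊑* vs
  ⊥*-minimum []       = []
  ⊥*-minimum (v ∷ vs) = ∙-minimum v ∷ ⊥*-minimum vs

  take-mono : ∀ m {n} {us vs : Vec V (m + n)} → us ⊑* vs → take m us ⊑* take m vs
  take-mono zero    ps       = []
  take-mono (suc m) (p ∷ ps) = p ∷ take-mono m ps

  drop-mono : ∀ m {n} {us vs : Vec V (m + n)} → us ⊑* vs → drop m us ⊑* drop m vs
  drop-mono zero    ps       = ps
  drop-mono (suc m) (p ∷ ps) = drop-mono m ps

  Stream : ℕ → Set
  Stream n = ℕ → Vec V n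

  _⊑ˢ_ : ∀ {n} → Rel (Stream n) 0ℓ
  σ ⊑ˢ τ = ∀ t → σ t ⊑* τ t

  _⊑[_]_ : ∀ {n} → Stream n → ℕ → Stream n → Set
  σ ⊑[ t ] τ = ∀ s → s ≤ t → σ s ⊑* τ s

  -- mono says at once that the function is monotone and that it is causal.
  -- Every denotation has this property; it makes the clause for Tr computable.
  record StreamFun (m n : ℕ) : Set where
    field
      at   : Stream m → Stream n
      mono : ∀ t {σ τ} → σ ⊑[ t ] τ → at σ t ⊑* at τ t
  open StreamFun

  causal : ∀ {m n} (f : StreamFun m n) t {σ τ} →
           (∀ s → s ≤ t → σ s ≡ τ s) → at f σ t ≡ at f τ t
  causal f t σ≡τ = ⊑*-antisym (mono f t λ s s≤t → ⊑*-reflexive (σ≡τ s s≤t))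
                              (mono f t λ s s≤t → ⊑*-reflexive (sym (σ≡τ s s≤t)))

  module LeastFixedPoint {x} (f : StreamFun x x) where

    iterate : ℕ → Stream x
    iterate zero    = λ _ → ⊥*
    iterate (suc k) = at f (iterate k)

    -- The restrictions of the iterates to times ≤ t take at most bound t values.
    bound : ℕ → ℕ
    bound t = (∣V∣ ^ x) ^ suc t

    μ : Stream x
    μ t = iterate (bound t) t

    private
      code : Vec V x → Fin (∣V∣ ^ x)
      code vs = funToFin (Inverse.to finite ∘ lookup vs)

      code-injective : ∀ {us vs} → code us ≡ code vs → us ≡ vs
      code-injective {us} {vs} eq = begin
        us                    ≡⟨ tabulate∘lookup us ⟨
        tabulate (lookup us)  ≡⟨ tabulate-cong pointwise ⟩
        tabulate (lookup vs)  ≡⟨ tabulate∘lookup vs ⟩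
        vs                    ∎
        where
        open ≡-Reasoning
        module Fi = Inverse finite
        pointwise : lookup us ≗ lookup vs
        pointwise i = begin
          lookup us i                            ≡⟨ Fi.strictlyInverseʳ _ ⟨
          Fi.from (Fi.to (lookup us i))          ≡⟨ cong Fi.from (Fin.finToFun-funToFin (Fi.to ∘ lookup us) i) ⟨
          Fi.from (finToFun (code us) i)         ≡⟨ cong (λ c → Fi.from (finToFun c i)) eq ⟩
          Fi.from (finToFun (code vs) i)         ≡⟨ cong Fi.from (Fin.finToFun-funToFin (Fi.to ∘ lookup vs) i) ⟩
          Fi.from (Fi.to (lookup vs i))          ≡⟨ Fi.strictlyInverseʳ _ ⟩
          lookup vs i                            ∎

      codeUpTo : ∀ t → Stream x → Fin (bound t)
      codeUpTo t σ = funToFin {suc t} (code ∘ σ ∘ toℕ)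

      codeUpTo-injective : ∀ t {σ τ} → codeUpTo t σ ≡ codeUpTo t τ →
                           ∀ s → s ≤ t → σ s ≡ τ s
      codeUpTo-injective t {σ} {τ} eq s s≤t = code-injective (begin
        code (σ s)                      ≡⟨ cong (code ∘ σ) (Fin.toℕ-fromℕ< (s≤s s≤t)) ⟨
        code (σ (toℕ i))                ≡⟨ Fin.finToFun-funToFin (code ∘ σ ∘ toℕ) i ⟨
        finToFun (codeUpTo t σ) i       ≡⟨ cong (λ c → finToFun c i) eq ⟩
        finToFun (codeUpTo t τ) i       ≡⟨ Fin.finToFun-funToFin (code ∘ τ ∘ toℕ) i ⟩
        code (τ (toℕ i))                ≡⟨ cong (code ∘ τ) (Fin.toℕ-fromℕ< (s≤s s≤t)) ⟩
        code (τ s)                      ∎)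
        where
        open ≡-Reasoning
        i : Fin (suc t)
        i = fromℕ< (s≤s s≤t)

      ascending : ∀ k → iterate k ⊑ˢ iterate (suc k)
      ascending zero    t = ⊥*-minimum _
      ascending (suc k) t = mono f t λ s _ → ascending k s

      ascending+ : ∀ j k → iterate k ⊑ˢ iterate (j + k)
      ascending+ zero    k t = ⊑*-reflexive refl
      ascending+ (suc j) k t = ⊑*-trans (ascending+ j k t) (ascending (j + k) t)

      ascending≤ : ∀ {k l} → k ≤ l → iterate k ⊑ˢ iterate l
      ascending≤ {k} {l} k≤l t =
        subst (λ j → iterate k t ⊑* iterate j t) (ℕ.m∸n+n≡m k≤l) (ascending+ (l ∸ k) k t)

      stable+ : ∀ t k → (∀ s → s ≤ t → iterate k s ≡ iterate (suc k) s) →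
                ∀ j s → s ≤ t → iterate k s ≡ iterate (j + k) s
      stable+ t k st zero    s s≤t = refl
      stable+ t k st (suc j) s s≤t =
        trans (st s s≤t) (causal f s λ r r≤s → stable+ t k st j r (ℕ.≤-trans r≤s s≤t))

      stable : ∀ t j s → s ≤ t → iterate (bound t) s ≡ iterate (j + bound t) s
      stable t j s s≤t
        with a , b , a<b , eq ← Fin.pigeonhole (ℕ.n<1+n (bound t))
                                  (λ (i : Fin (suc (bound t))) → codeUpTo t (iterate (toℕ i))) =
        trans (sym (from (toℕ a) (bound t) (ℕ.≤-pred (Fin.toℕ<n a)) step))
              (from (toℕ a) (j + bound t)
                    (ℕ.≤-trans (ℕ.≤-pred (Fin.toℕ<n a)) (ℕ.m≤n+m (bound t) j)) step)
        where
        step : ∀ r → r ≤ t → iterate (toℕ a) r ≡ iterate (suc (toℕ a)) r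
        step r r≤t = ⊑*-antisym (ascending (toℕ a) r)
          (⊑*-trans (ascending≤ a<b r)
                    (⊑*-reflexive (sym (codeUpTo-injective t {iterate (toℕ a)} {iterate (toℕ b)} eq r r≤t))))
        from : ∀ k l → k ≤ l → (∀ r → r ≤ t → iterate k r ≡ iterate (suc k) r) →
               iterate k s ≡ iterate l s
        from k l k≤l st =
          trans (stable+ t k st (l ∸ k) s s≤t) (cong (λ i → iterate i s) (ℕ.m∸n+n≡m k≤l))

      μ-iterate : ∀ t s → s ≤ t → μ s ≡ iterate (bound t) s
      μ-iterate t s s≤t = begin
        iterate (bound s) s             ≡⟨ stable s (bound t) s ℕ.≤-refl ⟩
        iterate (bound t + bound s) s   ≡⟨ cong (λ k → iterate k s) (ℕ.+-comm (bound t) (bound s)) ⟩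
        iterate (bound s + bound t) s   ≡⟨ stable t (bound s) s s≤t ⟨
        iterate (bound t) s             ∎
        where open ≡-Reasoning

    μ-fixed : ∀ t → at f μ t ≡ μ t
    μ-fixed t = trans (causal f t (μ-iterate t)) (sym (stable t 1 t ℕ.≤-refl))

    μ-least : ∀ τ → (∀ t → at f τ t ≡ τ t) → μ ⊑ˢ τ
    μ-least τ fixed t = below (bound t) t
      where
      below : ∀ k → iterate k ⊑ˢ τ
      below zero    s = ⊥*-minimum _
      below (suc k) s =
        ⊑*-trans (mono f s λ r _ → below k r) (⊑*-reflexive (fixed s))

  infixr 5 _++ˢ_
  _++ˢ_ : ∀ {m n} → Stream m → Stream n → Stream (m + n)
  (σ ++ˢ τ) t = σ t ++ τ t

  feedback : ∀ x {m n} → StreamFun (x + m) (x + n) → Stream m → StreamFun x x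
  at   (feedback x f σ) τ t    = take x (at f (τ ++ˢ σ) t)
  mono (feedback x f σ) t τ⊑τ′ =
    take-mono x (mono f t λ s s≤t → Pointwise.++⁺ (τ⊑τ′ s s≤t) (⊑*-reflexive refl))

  μ[_,_,_] : ∀ x {m n} → StreamFun (x + m) (x + n) → Stream m → Stream x
  μ[ x , f , σ ] = LeastFixedPoint.μ (feedback x f σ)

  traceˢ : ∀ x {m n} → StreamFun (x + m) (x + n) → StreamFun m n
  at   (traceˢ x f) σ t = drop x (at f (μ[ x , f , σ ] ++ˢ σ) t)
  mono (traceˢ x f) t {σ} {τ} σ⊑τ =
    drop-mono x (mono f t λ s s≤t →
      Pointwise.++⁺ (iterates (LeastFixedPoint.bound (feedback x f σ) s) s s≤t) (σ⊑τ s s≤t))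
    where
    open LeastFixedPoint using (iterate)
    iterates : ∀ k → iterate (feedback x f σ) k ⊑[ t ] iterate (feedback x f τ) k
    iterates zero    s s≤t = ⊑*-reflexive refl
    iterates (suc k) s s≤t = take-mono x (mono f s λ r r≤s →
      Pointwise.++⁺ (iterates k r (ℕ.≤-trans r≤s s≤t)) (σ⊑τ r (ℕ.≤-trans r≤s s≤t)))

  act : ∀ {m n} → CGen m n → Vec V m → Vec V n
  act (prim p) vs           = ⟦ p ⟧ᵖ vs
  act bot      []           = ∙ ∷ []
  act fork     (v ∷ [])     = v ∷ v ∷ []
  act join     (v ∷ w ∷ []) = (v ⊔ w) ∷ []
  act stub     (v ∷ [])     = []

  act-mono : ∀ {m n} (g : CGen m n) {us vs} → us ⊑* vs → act g us ⊑* act g vs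
  act-mono (prim p) ps            = monotone p ps
  act-mono bot      []            = L.refl ∷ []
  act-mono fork     (p ∷ [])      = p ∷ p ∷ []
  act-mono join {_ ∷ _ ∷ []} {v ∷ w ∷ []} (p ∷ q ∷ []) =
    proj₂ (proj₂ (L.supremum _ _)) (v ⊔ w)
      (L.trans p (proj₁ (L.supremum v w)))
      (L.trans q (proj₁ (proj₂ (L.supremum v w)))) ∷ []
  act-mono stub     (p ∷ [])      = []

  ⟦_⟧ᵍ : ∀ {m n} → SGen m n → StreamFun m n
  at   ⟦ comb g ⟧ᵍ  σ t       = act g (σ t)
  at   ⟦ val v _ ⟧ᵍ σ zero    = v ∷ []
  at   ⟦ val v _ ⟧ᵍ σ (suc t) = ∙ ∷ []
  at   ⟦ delay ⟧ᵍ   σ zero    = ∙ ∷ []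
  at   ⟦ delay ⟧ᵍ   σ (suc t) = σ t
  mono ⟦ comb g ⟧ᵍ  t       σ⊑τ = act-mono g (σ⊑τ t ℕ.≤-refl)
  mono ⟦ val v _ ⟧ᵍ zero    σ⊑τ = ⊑*-reflexive refl
  mono ⟦ val v _ ⟧ᵍ (suc t) σ⊑τ = ⊑*-reflexive refl
  mono ⟦ delay ⟧ᵍ   zero    σ⊑τ = ⊑*-reflexive refl
  mono ⟦ delay ⟧ᵍ   (suc t) σ⊑τ = σ⊑τ t (ℕ.n≤1+n t)

  _⨾ˢ_ : ∀ {m n k} → StreamFun m n → StreamFun n k → StreamFun m k
  at   (f ⨾ˢ g) σ     = at g (at f σ)
  mono (f ⨾ˢ g) t σ⊑τ =
    mono g t λ s s≤t → mono f s λ r r≤s → σ⊑τ r (ℕ.≤-trans r≤s s≤t)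

  _⊗ˢ_ : ∀ {m n m′ n′} → StreamFun m n → StreamFun m′ n′ → StreamFun (m + m′) (n + n′)
  at   (_⊗ˢ_ {m} f g) σ     = at f (take m ∘ σ) ++ˢ at g (drop m ∘ σ)
  mono (_⊗ˢ_ {m} f g) t σ⊑τ =
    Pointwise.++⁺ (mono f t λ s s≤t → take-mono m (σ⊑τ s s≤t))
                  (mono g t λ s s≤t → drop-mono m (σ⊑τ s s≤t))

  idˢ : ∀ n → StreamFun n n
  at   (idˢ n) σ     = σ
  mono (idˢ n) t σ⊑τ = σ⊑τ t ℕ.≤-refl

  swapˢ : ∀ m n → StreamFun (m + n) (n + m)
  at   (swapˢ m n) σ t     = drop m (σ t) ++ take m (σ t)
  mono (swapˢ m n) t σ⊑τ =
    Pointwise.++⁺ (drop-mono m (σ⊑τ t ℕ.≤-refl)) (take-mono m (σ⊑τ t ℕ.≤-refl))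

  ⟦_⟧ : ∀ {m n} → SCirc m n → StreamFun m n
  ⟦ gen g ⟧    = ⟦ g ⟧ᵍ
  ⟦ id n ⟧     = idˢ n
  ⟦ F ⨾ G ⟧    = ⟦ F ⟧ ⨾ˢ ⟦ G ⟧
  ⟦ F ⊗ G ⟧    = ⟦ F ⟧ ⊗ˢ ⟦ G ⟧
  ⟦ swap m n ⟧ = swapˢ m n
  ⟦ Tr x F ⟧   = traceˢ x ⟦ F ⟧

  Adequate : ∀ {ℓ} → CircRel ℓ → Set ℓ
  Adequate R = ∀ {m n} {F G : SCirc m n} → R F G → ∀ σ t → at ⟦ F ⟧ σ t ≡ at ⟦ G ⟧ σ t

module Observation {S : Signature} (I : Interpretation S) where
  open Signature S
  open Interpretation I
  open Circuits S

  _⊏*_ : ∀ {n} → Rel (Vec V n) 0ℓ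
  _⊏*_ = ToStrict._<_ _≡_ (Pointwise _⊑_)

  -- A chain of length d has d strict steps, hence d + 1 elements.
  Chain : ℕ → ℕ → Set
  Chain x d = Σ (Fin (suc d) → Vec V x) λ c → ∀ i → c (inject₁ i) ⊏* c (Fin.suc i)

  LongestChain : ℕ → ℕ → Set
  LongestChain x d = Chain x d × (∀ e → Chain x e → e ≤ d)

  unroll : ∀ {x m n} → CCirc (x + m) (x + n) → ℕ → CCirc m (x + n)
  unroll {x} {m} {n} C zero    = (bots x ⊗ id m) ⨾ C
  unroll {x} {m} {n} C (suc i) =
    forks m ⨾ (castᶜ refl (ℕ.+-identityʳ x) (unroll C i ⨾ (id x ⊗ stubs n)) ⊗ id m) ⨾ C

  regroup : ∀ x y z m → (x + y) + (z + m) ≡ (x + (y + z)) + m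
  regroup x y z m =
    trans (sym (ℕ.+-assoc (x + y) z m)) (cong (_+ m) (ℕ.+-assoc x y z))

  data Kind : Set where
    Mealy IF Str Val : Kind

  infix 4 _▷[_]_ _⇝[_]_ _⇝[Val]*_

  data _▷[_]_ : ∀ {m n} → SCirc m n → Kind → SCirc m n → Set where
    mealy : ∀ x y {z m n} (C : CCirc ((x + y) + (z + m)) ((x + y) + n)) (us : Vec V z) →
            Tr (x + y) (((id x ⊗ delays y) ⊗ (word us ⊗ id m)) ⨾ ⌈ C ⌉)
              ▷[ Mealy ]
            Tr (x + (y + z))
               (((id x ⊗ reg (replicate y ∙ ++ us)) ⊗ id m)
                 ⨾ cast (regroup x y z m) (regroup x y z n)
                        (⌈ C ⌉ ⨾ (id (x + y) ⊗ (⌈ bots z ⌉ ⊗ id n))))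

    unfold : ∀ {x m n d} (C : CCirc (x + m) (x + n)) → LongestChain x d →
             Tr x ⌈ C ⌉ ▷[ IF ] ⌈ unroll C d ⌉ ⨾ (⌈ stubs x ⌉ ⊗ id n)

    stream : ∀ {a b} (C : CCirc a b) (us : Vec V a) →
             reg us ⨾ ⌈ C ⌉
               ▷[ Str ]
             ((word us ⨾ ⌈ C ⌉) ⊗ (⌈ C ⌉ ⨾ delays b)) ⨾ ⌈ joins b ⌉

    fork-v : ∀ v → value v ⨾ gen (comb fork) ▷[ Val ] value v ⊗ value v
    join-v : ∀ v w → (value v ⊗ value w) ⨾ gen (comb join) ▷[ Val ] value (v ⊔ w)
    stub-v : ∀ v → value v ⨾ gen (comb stub) ▷[ Val ] id 0
    prim-v : ∀ p vs → word vs ⨾ gen (comb (prim p)) ▷[ Val ] word (⟦ p ⟧ᵖ vs)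

  data _⇝[_]_ : ∀ {m n} → SCirc m n → Kind → SCirc m n → Set where
    rule   : ∀ {m n k} {F G : SCirc m n} → F ▷[ k ] G → F ⇝[ k ] G
    modulo : ∀ {m n k} {F F′ G G′ : SCirc m n} →
             F ≈ F′ → F′ ⇝[ k ] G′ → G′ ≈ G → F ⇝[ k ] G
    in-⨾ˡ  : ∀ {m n l k} {F F′ : SCirc m n} {G : SCirc n l} →
             F ⇝[ k ] F′ → F ⨾ G ⇝[ k ] F′ ⨾ G
    in-⨾ʳ  : ∀ {m n l k} {F : SCirc m n} {G G′ : SCirc n l} →
             G ⇝[ k ] G′ → F ⨾ G ⇝[ k ] F ⨾ G′
    in-⊗ˡ  : ∀ {m n m′ n′ k} {F F′ : SCirc m n} {G : SCirc m′ n′} →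
             F ⇝[ k ] F′ → F ⊗ G ⇝[ k ] F′ ⊗ G
    in-⊗ʳ  : ∀ {m n m′ n′ k} {F : SCirc m n} {G G′ : SCirc m′ n′} →
             G ⇝[ k ] G′ → F ⊗ G ⇝[ k ] F ⊗ G′
    in-Tr  : ∀ {x m n k} {F F′ : SCirc (x + m) (x + n)} →
             F ⇝[ k ] F′ → Tr x F ⇝[ k ] Tr x F′

  _⇝[Val]*_ : ∀ {m n} → Rel (SCirc m n) 0ℓ
  _⇝[Val]*_ = Star _⇝[ Val ]_

  -- One use of productivity: (Mealy), (IF) and (Str) once each, in this order, and
  -- then value rules until the outputs at the current time have become values.
  Productive : ∀ {m n} → SCirc m n → Vec V m → SCirc m n → Vec V n → Set
  Productive F vs F′ ws =
    ∃[ F₁ ] ∃[ F₂ ] ∃[ F₃ ]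
      reg vs ⨾ F ⇝[ Mealy ] F₁ × F₁ ⇝[ IF ] F₂ × F₂ ⇝[ Str ] F₃ × F₃ ⇝[Val]* F′ ⨾ reg ws

  data Waveform {m n} (F : SCirc m n) : ∀ {k} → Vec (Vec V m) k → Vec (Vec V n) k → Set where
    []  : Waveform F [] []
    _∷_ : ∀ {k vs ws F′} {vss : Vec _ k} {wss} →
          Productive F vs F′ ws → Waveform F′ vss wss → Waveform F (vs ∷ vss) (ws ∷ wss)

  infix 4 _∼_

  -- c ranges over all common upper bounds for the numbers of delays of F and G.
  -- Restricting it to the least one would not be adequate: two one-delay circuits
  -- cycling through p and q values, p and q coprime, may agree for p + q - 2 ticks,
  -- which can exceed ∣V∣ + 1, and then differ.
  _∼_ : CircRel 0ℓ
  _∼_ {m} {n} F G =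
    ∀ c → #delays F ≤ c → #delays G ≤ c →
    ∀ (vss : Vec (Vec V m) (∣V∣ ^ c + 1)) (wss : Vec (Vec V n) (∣V∣ ^ c + 1)) →
    Waveform F vss wss ⇔ Waveform G vss wss

{-# OPTIONS --safe #-}
module Submission where

-- Productivity is sound and total.  Sound: all reductions preserve the denotation,
-- so reg vs ; F ⇝* F′ ; reg ws forces ⟦ F ⟧ (vs ∷ σ) = ws ∷ ⟦ F′ ⟧ σ, and output
-- waveforms are prefixes of the denotation.  Total: every circuit is a trace of
-- wires, delays and values followed by a combinational circuit, which is the
-- shape (Mealy) consumes.  As the bound c on the delays may be taken arbitrarily
-- large, F ∼ G holds exactly if F and G have the same denotation; that relation
-- is a congruence, and is the largest adequate one by definition of adequacy.

open import Defs
open import Level using (Level; 0ℓ)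
open import Data.Empty using (⊥-elim-irr)
open import Data.Nat.Base using (ℕ; zero; suc; _+_; _∸_; _^_; _≤_; _<_; z≤n; s≤s; s<s)
import Data.Nat.Properties as ℕ
open import Data.Fin.Base as Fin using (Fin; zero; suc; toℕ; fromℕ<; inject₁; combine)
import Data.Fin.Properties as Fin
open import Data.Vec.Base
  using (Vec; []; _∷_; _++_; take; drop; replicate; zipWith; lookup; tabulate)
open import Data.Vec.Properties
  using (take++drop≡id; ≡-dec; zipWith-identityˡ; zipWith-identityʳ; tabulate∘lookup; tabulate-cong)
open import Data.Vec.Relation.Binary.Pointwise.Inductive as Pointwise using ([]; _∷_)
import Data.Vec.Relation.Binary.Equality.Propositional as ≋
open import Data.Product.Base using (Σ; ∃; ∃-syntax; _×_; _,_; proj₁; proj₂)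
open import Data.Sum.Base using (_⊎_; inj₁; inj₂)
open import Function.Base using (_∘_)
open import Function.Bundles using (module Inverse; module Equivalence; mk⇔)
open import Relation.Nullary.Decidable using (Dec; yes; no; map′; _×-dec_; ¬?)
open import Relation.Nullary.Negation using (contradiction)
import Relation.Unary as Unary
open import Relation.Binary.Core using (Rel)
open import Relation.Binary.Definitions using (Decidable; Transitive)
open import Relation.Binary.Lattice.Bundles using (BoundedJoinSemilattice)
open import Relation.Binary.Lattice.Structures using (IsLattice)
import Relation.Binary.Lattice.Properties.BoundedJoinSemilattice as BoundedJoinSemilatticeProperties
open import Relation.Binary.Construct.Closure.ReflexiveTransitive as Star using (Star; ε; _◅_; _◅◅_)
open import Relation.Binary.PropositionalEquality
  using (_≡_; _≢_; refl; sym; trans; cong; cong₂; subst; module ≡-Reasoning)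

-- Symmetric traced monoidal categories

-- `Productive` is a relation: a circuit has many Mealy forms, so neither the residual circuit nor
-- the output word is visibly determined, and confluence of the rewriting is not established.
-- Determinacy is taken from the semantics instead. Soundness pins every waveform on a given input
-- to the same prefix of the denotation, and totality provides one for each circuit; together they
-- carry a waveform of `F` over to any `G` with the same denotation.
--
-- Two obstacles shape the rest. A trace may feed wires back with or without a delay, and (IF)
-- applies only to a loop around a combinational circuit; so the delay-free loop has to be separated
-- from the registers before it is unrolled. And strictness makes `_≈_` relate terms whose
-- boundaries are only propositionally equal, so that the semantic side needs an equally
-- heterogeneous relation, `_≅_`.

module TracedLaws (S : Signature) where
  open Signature S
  open Circuits S

  module ≈-Reasoning where

    infixr 2 _≈⟨_⟩_ _≈⟨_⟨_
    infix  3 _∎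

    _≈⟨_⟩_ : ∀ {m n m′ n′ m″ n″} (F : SCirc m n) {G : SCirc m′ n′} {H : SCirc m″ n″} →
             F ≈ G → G ≈ H → F ≈ H
    F ≈⟨ p ⟩ q = ≈-trans p q

    _≈⟨_⟨_ : ∀ {m n m′ n′ m″ n″} (F : SCirc m n) {G : SCirc m′ n′} {H : SCirc m″ n″} →
             G ≈ F → G ≈ H → F ≈ H
    F ≈⟨ p ⟨ q = ≈-trans (≈-sym p) q

    _∎ : ∀ {m n} (F : SCirc m n) → F ≈ F
    F ∎ = ≈-refl

  open ≈-Reasoning

  ≡⇒≈ : ∀ {m n} {F G : SCirc m n} → F ≡ G → F ≈ G
  ≡⇒≈ refl = ≈-refl

  cast-≈ : ∀ {m n m′ n′} (p : m ≡ m′) (q : n ≡ n′) {F : SCirc m n} → cast p q F ≈ F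
  cast-≈ refl refl = ≈-refl

  castᶜ-≈ : ∀ {m n m′ n′} (p : m ≡ m′) (q : n ≡ n′) {C : CCirc m n} →
            ⌈ castᶜ p q C ⌉ ≈ ⌈ C ⌉
  castᶜ-≈ refl refl = ≈-refl

  id-≡ : ∀ {m n} → m ≡ n → id m ≈ id n
  id-≡ refl = ≈-refl

  ⨾-congˡ : ∀ {m n k m′} {F : SCirc m n} {F′ : SCirc m′ n} {G : SCirc n k} →
            F ≈ F′ → F ⨾ G ≈ F′ ⨾ G
  ⨾-congˡ p = ⨾-cong p ≈-refl

  ⨾-congʳ : ∀ {m n k k′} {F : SCirc m n} {G : SCirc n k} {G′ : SCirc n k′} →
            G ≈ G′ → F ⨾ G ≈ F ⨾ G′
  ⨾-congʳ p = ⨾-cong ≈-refl p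

  ⊗-congˡ : ∀ {m n k l m′ n′} {F : SCirc m n} {F′ : SCirc m′ n′} {G : SCirc k l} →
            F ≈ F′ → F ⊗ G ≈ F′ ⊗ G
  ⊗-congˡ p = ⊗-cong p ≈-refl

  ⊗-congʳ : ∀ {m n k l k′ l′} {F : SCirc m n} {G : SCirc k l} {G′ : SCirc k′ l′} →
            G ≈ G′ → F ⊗ G ≈ F ⊗ G′
  ⊗-congʳ p = ⊗-cong ≈-refl p

  whiskerʳ-⨾ : ∀ {m n k l} {F : SCirc m n} {G : SCirc n k} →
               (F ⨾ G) ⊗ id l ≈ (F ⊗ id l) ⨾ (G ⊗ id l)
  whiskerʳ-⨾ = ≈-trans (⊗-congʳ (≈-sym ⨾-identityˡ)) interchange

  ⊗-splitˡ : ∀ {m n k l} {F : SCirc m n} {G : SCirc k l} →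
             F ⊗ G ≈ (F ⊗ id k) ⨾ (id n ⊗ G)
  ⊗-splitˡ = ≈-trans (⊗-cong (≈-sym ⨾-identityʳ) (≈-sym ⨾-identityˡ)) interchange

  ⊗-splitʳ : ∀ {m n k l} {F : SCirc m n} {G : SCirc k l} →
             F ⊗ G ≈ (id m ⊗ G) ⨾ (F ⊗ id l)
  ⊗-splitʳ = ≈-trans (⊗-cong (≈-sym ⨾-identityˡ) (≈-sym ⨾-identityʳ)) interchange

  ⊗-exchange : ∀ {m n k l} {F : SCirc m n} {G : SCirc k l} →
               (id m ⊗ G) ⨾ (F ⊗ id l) ≈ (F ⊗ id k) ⨾ (id n ⊗ G)
  ⊗-exchange = ≈-trans (≈-sym ⊗-splitʳ) ⊗-splitˡ

  tightenˡ : ∀ {x m n m′} {F : SCirc m′ m} {G : SCirc (x + m) (x + n)} →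
             F ⨾ Tr x G ≈ Tr x ((id x ⊗ F) ⨾ G)
  tightenˡ {x} {F = F} {G} =
    F ⨾ Tr x G                            ≈⟨ ⨾-identityʳ ⟨
    F ⨾ Tr x G ⨾ id _                     ≈⟨ tightening ⟨
    Tr x ((id x ⊗ F) ⨾ G ⨾ (id x ⊗ id _)) ≈⟨ Tr-cong (≈-trans (⨾-congʳ ⊗-id) ⨾-identityʳ) ⟩
    Tr x ((id x ⊗ F) ⨾ G)                 ∎

  tightenʳ : ∀ {x m n n′} {G : SCirc (x + m) (x + n)} {H : SCirc n n′} →
             Tr x G ⨾ H ≈ Tr x (G ⨾ (id x ⊗ H))
  tightenʳ {x} {G = G} {H} =
    Tr x G ⨾ H                            ≈⟨ ⨾-congˡ ⨾-identityˡ ⟨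
    id _ ⨾ Tr x G ⨾ H                     ≈⟨ tightening ⟨
    Tr x ((id x ⊗ id _) ⨾ G ⨾ (id x ⊗ H)) ≈⟨ Tr-cong (⨾-congˡ (≈-trans (⨾-congˡ ⊗-id) ⨾-identityˡ)) ⟩
    Tr x (G ⨾ (id x ⊗ H))                 ∎

  -- `superposing` tensors a trace with a circuit on its right only; conjugation by the symmetry
  -- transfers such results to the left.
  whiskerˡ-swap : ∀ {k m n} {G : SCirc m n} →
                  id k ⊗ G ≈ swap k m ⨾ (G ⊗ id k) ⨾ swap n k
  whiskerˡ-swap {k} {m} {n} {G} =
    id k ⊗ G                              ≈⟨ ⨾-identityʳ ⟨
    (id k ⊗ G) ⨾ id (k + n)               ≈⟨ ⨾-congʳ swap-involutive ⟨
    (id k ⊗ G) ⨾ (swap k n ⨾ swap n k)    ≈⟨ ⨾-assoc ⟨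
    (id k ⊗ G) ⨾ swap k n ⨾ swap n k      ≈⟨ ⨾-congˡ swap-natural ⟩
    swap k m ⨾ (G ⊗ id k) ⨾ swap n k      ∎

  -- The hexagon at n = k = 0 makes swap m 0 idempotent, and it is invertible.
  module UnitSwap (m : ℕ) where

    s t : SCirc m m
    s = cast (ℕ.+-identityʳ m) refl (swap m 0)
    t = cast refl (ℕ.+-identityʳ m) (swap 0 m)

    swap≈s : swap m 0 ≈ s
    swap≈s = ≈-sym (cast-≈ (ℕ.+-identityʳ m) refl)

    swap≈t : swap 0 m ≈ t
    swap≈t = ≈-sym (cast-≈ refl (ℕ.+-identityʳ m))

    s⨾t≈id : s ⨾ t ≈ id m
    s⨾t≈id =
      s ⨾ t               ≈⟨ ⨾-cong swap≈s swap≈t ⟨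
      swap m 0 ⨾ swap 0 m ≈⟨ swap-involutive ⟩
      id (m + 0)          ≈⟨ id-≡ (ℕ.+-identityʳ m) ⟩
      id m                ∎

    s≈s⨾s : s ≈ s ⨾ s
    s≈s⨾s = ≈-trans (≈-sym swap≈s) (≈-trans (swap-hexagon {m} {0} {0}) (⨾-cong
      (≈-trans (cast-≈ (ℕ.+-assoc m 0 0) (ℕ.+-assoc 0 m 0)) (≈-trans ⊗-identityʳ swap≈s))
      (≈-trans (cast-≈ refl (sym (ℕ.+-assoc 0 0 m))) (≈-trans ⊗-identityˡ swap≈s))))

    s≈id : s ≈ id m
    s≈id =
      s             ≈⟨ ⨾-identityʳ ⟨
      s ⨾ id m      ≈⟨ ⨾-congʳ s⨾t≈id ⟨
      s ⨾ (s ⨾ t)   ≈⟨ ⨾-assoc ⟨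
      s ⨾ s ⨾ t     ≈⟨ ⨾-congˡ s≈s⨾s ⟨
      s ⨾ t         ≈⟨ s⨾t≈id ⟩
      id m          ∎

  swap-0ˡ : ∀ m → swap 0 m ≈ id m
  swap-0ˡ m =
    swap 0 m      ≈⟨ swap≈t ⟩
    t             ≈⟨ ⨾-identityˡ ⟨
    id m ⨾ t      ≈⟨ ⨾-congˡ s≈id ⟨
    s ⨾ t         ≈⟨ s⨾t≈id ⟩
    id m          ∎
    where open UnitSwap m

  -- The permutation behind the middle-four interchange. The cast gives it boundaries that compose
  -- with tensors of tensors; `mix-≈` discards the cast again.
  mix : ∀ a b c d → CCirc ((a + b) + (c + d)) ((a + c) + (b + d))
  mix a b c d = castᶜ (regroup b c) (regroup c b) (id a ⊗ (swap b c ⊗ id d))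
    where
    regroup : ∀ b c → a + ((b + c) + d) ≡ (a + b) + (c + d)
    regroup b c = trans (cong (a +_) (ℕ.+-assoc b c d)) (sym (ℕ.+-assoc a b (c + d)))

  mix-≈ : ∀ a b c d → ⌈ mix a b c d ⌉ ≈ id a ⊗ (swap b c ⊗ id d)
  mix-≈ a b c d = castᶜ-≈ _ _

  ⊗-regroup : ∀ {a a′ b b′ c c′ d d′} {A : SCirc a a′} {B : SCirc b b′}
              {C : SCirc c c′} {D : SCirc d d′} →
              (A ⊗ B) ⊗ (C ⊗ D) ≈ A ⊗ ((B ⊗ C) ⊗ D)
  ⊗-regroup = ≈-trans ⊗-assoc (⊗-congʳ (≈-sym ⊗-assoc))

  mix-natural : ∀ {a a′ b b′ c c′ d d′} {A : SCirc a a′} {B : SCirc b b′}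
                {C : SCirc c c′} {D : SCirc d d′} →
                ((A ⊗ B) ⊗ (C ⊗ D)) ⨾ ⌈ mix a′ b′ c′ d′ ⌉ ≈
                ⌈ mix a b c d ⌉ ⨾ ((A ⊗ C) ⊗ (B ⊗ D))
  mix-natural {a} {a′} {b} {b′} {c} {c′} {d} {d′} {A} {B} {C} {D} =
    ((A ⊗ B) ⊗ (C ⊗ D)) ⨾ ⌈ mix a′ b′ c′ d′ ⌉
      ≈⟨ ⨾-cong ⊗-regroup (mix-≈ a′ b′ c′ d′) ⟩
    (A ⊗ ((B ⊗ C) ⊗ D)) ⨾ (id a′ ⊗ (swap b′ c′ ⊗ id d′))
      ≈⟨ ≈-trans (⊗-congʳ interchange) interchange ⟨
    (A ⨾ id a′) ⊗ (((B ⊗ C) ⨾ swap b′ c′) ⊗ (D ⨾ id d′))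
      ≈⟨ ⊗-cong id-commute (⊗-cong swap-natural id-commute) ⟩
    (id a ⨾ A) ⊗ ((swap b c ⨾ (C ⊗ B)) ⊗ (id d ⨾ D))
      ≈⟨ ≈-trans (⊗-congʳ interchange) interchange ⟩
    (id a ⊗ (swap b c ⊗ id d)) ⨾ (A ⊗ ((C ⊗ B) ⊗ D))
      ≈⟨ ⨾-cong (mix-≈ a b c d) ⊗-regroup ⟨
    ⌈ mix a b c d ⌉ ⨾ ((A ⊗ C) ⊗ (B ⊗ D)) ∎
    where
    id-commute : ∀ {m n} {F : SCirc m n} → F ⨾ id n ≈ id m ⨾ F
    id-commute = ≈-trans ⨾-identityʳ (≈-sym ⨾-identityˡ)

  mix-involutive : ∀ {a b c d} → ⌈ mix a b c d ⌉ ⨾ ⌈ mix a c b d ⌉ ≈ id ((a + b) + (c + d))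
  mix-involutive {a} {b} {c} {d} =
    ⌈ mix a b c d ⌉ ⨾ ⌈ mix a c b d ⌉
      ≈⟨ ⨾-cong (mix-≈ a b c d) (mix-≈ a c b d) ⟩
    (id a ⊗ (swap b c ⊗ id d)) ⨾ (id a ⊗ (swap c b ⊗ id d))
      ≈⟨ ≈-trans (⊗-congʳ interchange) interchange ⟨
    (id a ⨾ id a) ⊗ ((swap b c ⨾ swap c b) ⊗ (id d ⨾ id d))
      ≈⟨ ⊗-cong ⨾-identityˡ (⊗-cong swap-involutive ⨾-identityˡ) ⟩
    id a ⊗ (id (b + c) ⊗ id d)
      ≈⟨ ≈-trans (⊗-congʳ ⊗-id) ⊗-id ⟩
    id (a + ((b + c) + d))
      ≈⟨ id-≡ (trans (cong (a +_) (ℕ.+-assoc b c d)) (sym (ℕ.+-assoc a b (c + d)))) ⟩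
    id ((a + b) + (c + d)) ∎

  middle-four : ∀ {a a′ b b′ c c′ d d′} {A : SCirc a a′} {B : SCirc b b′}
                {C : SCirc c c′} {D : SCirc d d′} →
                (A ⊗ B) ⊗ (C ⊗ D) ≈
                ⌈ mix a b c d ⌉ ⨾ ((A ⊗ C) ⊗ (B ⊗ D)) ⨾ ⌈ mix a′ c′ b′ d′ ⌉
  middle-four {a} {a′} {b} {b′} {c} {c′} {d} {d′} {A} {B} {C} {D} =
    (A ⊗ B) ⊗ (C ⊗ D)
      ≈⟨ ⨾-identityʳ ⟨
    ((A ⊗ B) ⊗ (C ⊗ D)) ⨾ id _
      ≈⟨ ⨾-congʳ mix-involutive ⟨
    ((A ⊗ B) ⊗ (C ⊗ D)) ⨾ (⌈ mix a′ b′ c′ d′ ⌉ ⨾ ⌈ mix a′ c′ b′ d′ ⌉)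
      ≈⟨ ⨾-assoc ⟨
    ((A ⊗ B) ⊗ (C ⊗ D)) ⨾ ⌈ mix a′ b′ c′ d′ ⌉ ⨾ ⌈ mix a′ c′ b′ d′ ⌉
      ≈⟨ ⨾-congˡ mix-natural ⟩
    ⌈ mix a b c d ⌉ ⨾ ((A ⊗ C) ⊗ (B ⊗ D)) ⨾ ⌈ mix a′ c′ b′ d′ ⌉ ∎

  delays-+ : ∀ m n → delays (m + n) ≈ delays m ⊗ delays n
  delays-+ zero    n = ≈-sym ⊗-identityˡ
  delays-+ (suc m) n = ≈-trans (⊗-congʳ (delays-+ m n)) (≈-sym ⊗-assoc)

  word-++ : ∀ {m n} (us : Vec V m) (vs : Vec V n) → word (us ++ vs) ≈ word us ⊗ word vs
  word-++ []       vs = ≈-sym ⊗-identityˡ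
  word-++ (u ∷ us) vs = ≈-trans (⊗-congʳ (word-++ us vs)) (≈-sym ⊗-assoc)

  -- A word has no inputs, so by naturality the swap inside `joins` becomes `swap 0 1`, which is an
  -- identity, and the first delay moves past the remaining values for free.
  reg-∷ : ∀ {n} v (vs : Vec V n) →
          reg (v ∷ vs) ≈ ((value v ⊗ gen delay) ⨾ gen (comb join)) ⊗ reg vs
  reg-∷ {n} v vs =
    ((value v ⊗ word vs) ⊗ (gen delay ⊗ delays n)) ⨾ (⌈ shuffle ⌉ ⨾ (gen (comb join) ⊗ ⌈ joins n ⌉))
      ≈⟨ ⨾-assoc ⟨
    ((value v ⊗ word vs) ⊗ (gen delay ⊗ delays n)) ⨾ ⌈ shuffle ⌉ ⨾ (gen (comb join) ⊗ ⌈ joins n ⌉)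
      ≈⟨ ⨾-congˡ shuffled ⟩
    ((value v ⊗ gen delay) ⊗ (word vs ⊗ delays n)) ⨾ (gen (comb join) ⊗ ⌈ joins n ⌉)
      ≈⟨ interchange ⟨
    ((value v ⊗ gen delay) ⨾ gen (comb join)) ⊗ reg vs ∎
    where
    shuffle : CCirc (suc n + suc n) (2 + (n + n))
    shuffle = castᶜ (cong suc (ℕ.+-assoc n 1 n)) refl (id 1 ⊗ (swap n 1 ⊗ id n))

    swapped : (word vs ⊗ gen delay) ⨾ swap n 1 ≈ gen delay ⊗ word vs
    swapped = ≈-trans swap-natural (≈-trans (⨾-congˡ (swap-0ˡ 1)) ⨾-identityˡ)

    shuffled : ((value v ⊗ word vs) ⊗ (gen delay ⊗ delays n)) ⨾ ⌈ shuffle ⌉ ≈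
               (value v ⊗ gen delay) ⊗ (word vs ⊗ delays n)
    shuffled =
      ((value v ⊗ word vs) ⊗ (gen delay ⊗ delays n)) ⨾ ⌈ shuffle ⌉
        ≈⟨ ⨾-cong ⊗-regroup (castᶜ-≈ (cong suc (ℕ.+-assoc n 1 n)) refl) ⟩
      (value v ⊗ ((word vs ⊗ gen delay) ⊗ delays n)) ⨾ (id 1 ⊗ (swap n 1 ⊗ id n))
        ≈⟨ ≈-trans (⊗-congʳ interchange) interchange ⟨
      (value v ⨾ id 1) ⊗ (((word vs ⊗ gen delay) ⨾ swap n 1) ⊗ (delays n ⨾ id n))
        ≈⟨ ⊗-cong ⨾-identityʳ (⊗-cong swapped ⨾-identityʳ) ⟩
      value v ⊗ ((gen delay ⊗ word vs) ⊗ delays n)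
        ≈⟨ ⊗-regroup ⟨
      (value v ⊗ gen delay) ⊗ (word vs ⊗ delays n) ∎

  -- Merges the register of the state with that of the input, so that a single use of (Str) treats
  -- both, and separates the new state from the output afterwards.
  reg-++ : ∀ {m n} (us : Vec V m) (vs : Vec V n) → reg (us ++ vs) ≈ reg us ⊗ reg vs
  reg-++ [] vs = ≈-sym (≈-trans (⊗-congˡ (≈-trans ⨾-identityʳ ⊗-identityˡ)) ⊗-identityˡ)
  reg-++ (u ∷ us) vs =
    reg (u ∷ (us ++ vs))          ≈⟨ reg-∷ u (us ++ vs) ⟩
    _ ⊗ reg (us ++ vs)            ≈⟨ ⊗-congʳ (reg-++ us vs) ⟩
    _ ⊗ (reg us ⊗ reg vs)         ≈⟨ ⊗-assoc ⟨
    (_ ⊗ reg us) ⊗ reg vs         ≈⟨ ⊗-congˡ (reg-∷ u us) ⟨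
    reg (u ∷ us) ⊗ reg vs         ∎

-- Normal forms

module NormalForms (S : Signature) where
  open Signature S
  open Circuits S
  open TracedLaws S
  open ≈-Reasoning

  -- What may stand between the feedback and the combinational core: `wires` arise from traces, the
  -- other two atoms from delays and values.
  data State : ∀ {a b} → SCirc a b → Set where
    wires : ∀ k → State (id k)
    latch : State (gen delay)
    word₁ : ∀ v → State (value v)
    _⊗_   : ∀ {a b a′ b′} {H : SCirc a b} {H′ : SCirc a′ b′} →
            State H → State H′ → State (H ⊗ H′)

  -- The numbers `a` and `b` differ in general, because a value in the state has an output but no
  -- input.
  record Normal {m n} (F : SCirc m n) : Set where
    constructor normal
    field
      {a b} : ℕ
      {H}   : SCirc a b
      state : State H
      C     : CCirc (b + m) (a + n)
      eq    : F ≈ Tr a ((H ⊗ id m) ⨾ ⌈ C ⌉)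

  normal-resp-≈ : ∀ {m n} {F G : SCirc m n} → F ≈ G → Normal G → Normal F
  normal-resp-≈ F≈G (normal h C eq) = normal h C (≈-trans F≈G eq)

  normal-comb : ∀ {m n} (C : CCirc m n) → Normal ⌈ C ⌉
  normal-comb C = normal (wires 0) C
    (≈-sym (≈-trans vanishing₀ (≈-trans (⨾-congˡ ⊗-identityˡ) ⨾-identityˡ)))

  -- By naturality the delay passes through the swap and out of the loop; yanking removes what is
  -- left.
  normal-delay : Normal (gen delay)
  normal-delay = normal latch (swap 1 1) (≈-sym (
    Tr 1 ((gen delay ⊗ id 1) ⨾ swap 1 1) ≈⟨ Tr-cong swap-natural ⟩
    Tr 1 (swap 1 1 ⨾ (id 1 ⊗ gen delay)) ≈⟨ tightenʳ ⟨
    Tr 1 (swap 1 1) ⨾ gen delay          ≈⟨ ⨾-congˡ yanking ⟩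
    id 1 ⨾ gen delay                     ≈⟨ ⨾-identityˡ ⟩
    gen delay                            ∎))

  normal-value : ∀ v → Normal (value v)
  normal-value v = normal (word₁ v) (id 1)
    (≈-sym (≈-trans vanishing₀ (≈-trans ⨾-identityʳ ⊗-identityʳ)))

  normal-pre : ∀ {l m n} (D : CCirc l m) {F : SCirc m n} → Normal F → Normal (⌈ D ⌉ ⨾ F)
  normal-pre {l} {m} D {F} (normal {a} {b} {H} h C eq) = normal h ((id b ⊗ D) ⨾ C) (
    ⌈ D ⌉ ⨾ F
      ≈⟨ ⨾-congʳ eq ⟩
    ⌈ D ⌉ ⨾ Tr a ((H ⊗ id m) ⨾ ⌈ C ⌉)
      ≈⟨ tightenˡ ⟩
    Tr a ((id a ⊗ ⌈ D ⌉) ⨾ ((H ⊗ id m) ⨾ ⌈ C ⌉))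
      ≈⟨ Tr-cong (≈-trans (≈-sym ⨾-assoc) (≈-trans (⨾-congˡ ⊗-exchange) ⨾-assoc)) ⟩
    Tr a ((H ⊗ id l) ⨾ ((id b ⊗ ⌈ D ⌉) ⨾ ⌈ C ⌉)) ∎)

  normal-post : ∀ {m n k} {F : SCirc m n} (D : CCirc n k) → Normal F → Normal (F ⨾ ⌈ D ⌉)
  normal-post D (normal {a} h C eq) = normal h (C ⨾ (id a ⊗ D))
    (≈-trans (⨾-congˡ eq) (≈-trans tightenʳ (Tr-cong ⨾-assoc)))

  normal-whiskerʳ : ∀ {m n} {F : SCirc m n} k → Normal F → Normal (F ⊗ id k)
  normal-whiskerʳ {m} {n} {F} k (normal {a} {b} {H} h C eq) =
    normal h (castᶜ (ℕ.+-assoc b m k) (ℕ.+-assoc a n k) (C ⊗ id k)) (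
    F ⊗ id k
      ≈⟨ ⊗-congˡ eq ⟩
    Tr a ((H ⊗ id m) ⨾ ⌈ C ⌉) ⊗ id k
      ≈⟨ superposing ⟩
    Tr a (cast (ℕ.+-assoc a m k) (ℕ.+-assoc a n k) (((H ⊗ id m) ⨾ ⌈ C ⌉) ⊗ id k))
      ≈⟨ Tr-cong (≈-trans (cast-≈ (ℕ.+-assoc a m k) (ℕ.+-assoc a n k)) (≈-trans whiskerʳ-⨾
           (⨾-cong (≈-trans ⊗-assoc (⊗-congʳ ⊗-id))
                   (≈-sym (castᶜ-≈ (ℕ.+-assoc b m k) (ℕ.+-assoc a n k)))))) ⟩
    Tr a ((H ⊗ id (m + k)) ⨾ ⌈ castᶜ (ℕ.+-assoc b m k) (ℕ.+-assoc a n k) (C ⊗ id k) ⌉) ∎)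

  normal-whiskerˡ : ∀ {m n} k {F : SCirc m n} → Normal F → Normal (id k ⊗ F)
  normal-whiskerˡ {m} {n} k N = normal-resp-≈ whiskerˡ-swap
    (normal-post (swap n k) (normal-pre (swap k m) (normal-whiskerʳ k N)))

  -- Two nested traces are one by vanishing, and their states are then juxtaposed. Both closure
  -- under trace and closure under composition are reduced to this shape.
  normal-nested : ∀ {a′ b′ a b m n} {H′ : SCirc a′ b′} {H : SCirc a b}
                  (C : CCirc (b′ + (b + m)) (a′ + (a + n))) {F : SCirc m n} →
                  State H′ → State H →
                  F ≈ Tr a (Tr a′ ((H′ ⊗ (H ⊗ id m)) ⨾ ⌈ C ⌉)) → Normal F
  normal-nested {a′} {b′} {a} {b} {m} {n} {H′} {H} C h′ h eq =
    normal (h′ ⊗ h) C′ (≈-trans eq (≈-sym (≈-trans (vanishing₊ {a′} {a}) (Tr-cong (Tr-cong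
      (≈-trans (cast-≈ (ℕ.+-assoc a′ a m) (ℕ.+-assoc a′ a n))
        (⨾-cong ⊗-assoc
          (castᶜ-≈ (sym (ℕ.+-assoc b′ b m)) (sym (ℕ.+-assoc a′ a n))))))))))
    where
    C′ : CCirc ((b′ + b) + m) ((a′ + a) + n)
    C′ = castᶜ (sym (ℕ.+-assoc b′ b m)) (sym (ℕ.+-assoc a′ a n)) C

  normal-Tr : ∀ x {m n} {F : SCirc (x + m) (x + n)} → Normal F → Normal (Tr x F)
  normal-Tr x (normal h C eq) = normal-nested C h (wires x)
    (Tr-cong (≈-trans eq (Tr-cong (⨾-congˡ (⊗-congʳ (≈-sym ⊗-id))))))

  -- Tightening pulls `G` into the trace of `F`, behind the core `C`. There `C ⨾ (id a ⊗ G)` is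
  -- itself brought to normal form, which yields an inner trace whose state commutes past that of
  -- `F`.
  normal-⨾ : ∀ {m n k} {F : SCirc m n} {G : SCirc n k} →
             Normal F → Normal G → Normal (F ⨾ G)
  normal-⨾ {m} {n} {k} {F} {G} (normal {a} {b} {H} h C eq) N
    with normal {a′} {b′} {H′} h′ C′ eq′ ← normal-pre C (normal-whiskerˡ a N) =
    normal-nested C′ h′ h (
    F ⨾ G
      ≈⟨ ⨾-congˡ eq ⟩
    Tr a ((H ⊗ id m) ⨾ ⌈ C ⌉) ⨾ G
      ≈⟨ tightenʳ ⟩
    Tr a ((H ⊗ id m) ⨾ ⌈ C ⌉ ⨾ (id a ⊗ G))
      ≈⟨ Tr-cong (≈-trans ⨾-assoc (≈-trans (⨾-congʳ eq′) tightenˡ)) ⟩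
    Tr a (Tr a′ ((id a′ ⊗ (H ⊗ id m)) ⨾ ((H′ ⊗ id (b + m)) ⨾ ⌈ C′ ⌉)))
      ≈⟨ Tr-cong (Tr-cong (≈-trans (≈-sym ⨾-assoc) (⨾-congˡ (≈-sym ⊗-splitʳ)))) ⟩
    Tr a (Tr a′ ((H′ ⊗ (H ⊗ id m)) ⨾ ⌈ C′ ⌉)) ∎)

  value-val : ∀ v .(v≢∙ : v ≢ ∙) → value v ≡ gen (val v v≢∙)
  value-val v v≢∙ with v ≟ ∙
  ... | yes v≡∙ = ⊥-elim-irr (v≢∙ v≡∙)
  ... | no _    = refl

  value-∙ : value ∙ ≡ gen (comb bot)
  value-∙ with ∙ ≟ ∙
  ... | yes _   = refl
  ... | no ∙≢∙ = contradiction refl ∙≢∙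

  normalise : ∀ {m n} (F : SCirc m n) → Normal F
  normalise (gen (comb g))    = normal-comb (gen g)
  normalise (gen (val v v≢∙)) = normal-resp-≈ (≡⇒≈ (sym (value-val v v≢∙))) (normal-value v)
  normalise (gen delay)       = normal-delay
  normalise (id n)            = normal-comb (id n)
  normalise (F ⨾ G)           = normal-⨾ (normalise F) (normalise G)
  normalise (_⊗_ {m = m} {n} {m′} {n′} F G) = normal-resp-≈ ⊗-splitˡ
    (normal-⨾ (normal-whiskerʳ m′ (normalise F)) (normal-whiskerˡ n (normalise G)))
  normalise (swap m n)        = normal-comb (swap m n)
  normalise (Tr x F)          = normal-Tr x (normalise F)

  -- (Mealy) expects the state in the order wires, delays, values, whereas a `State` is an arbitrary
  -- tensor of these. The `+ 0` in the type of `π` is the empty domain of `word us`.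
  record Sorted {a b} (H : SCirc a b) : Set where
    constructor sorted
    field
      x y {z} : ℕ
      us      : Vec V z
      π       : CCirc a ((x + y) + 0)
      ρ       : CCirc ((x + y) + z) b
      eq      : H ≈ ⌈ π ⌉ ⨾ ((id x ⊗ delays y) ⊗ word us) ⨾ ⌈ ρ ⌉

  sort : ∀ {a b} {H : SCirc a b} → State H → Sorted H
  sort (wires k) = sorted k 0 [] (castᶜ refl k≡k+0+0 (id k)) (castᶜ k≡k+0+0 refl (id k)) (≈-sym (
    ⌈ castᶜ refl k≡k+0+0 (id k) ⌉ ⨾ ((id k ⊗ id 0) ⊗ id 0) ⨾ ⌈ castᶜ k≡k+0+0 refl (id k) ⌉
      ≈⟨ ⨾-cong (⨾-cong (castᶜ-≈ refl k≡k+0+0) (≈-trans ⊗-identityʳ ⊗-identityʳ)) (castᶜ-≈ k≡k+0+0 refl) ⟩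
    id k ⨾ id k ⨾ id k
      ≈⟨ ≈-trans ⨾-identityʳ ⨾-identityʳ ⟩
    id k ∎))
    where
    k≡k+0+0 : k ≡ (k + 0) + 0
    k≡k+0+0 = sym (trans (ℕ.+-identityʳ (k + 0)) (ℕ.+-identityʳ k))
  sort latch = sorted 0 1 [] (id 1) (id 1) (≈-sym (
    ≈-trans ⨾-identityʳ (≈-trans ⨾-identityˡ (≈-trans ⊗-identityʳ (≈-trans ⊗-identityˡ ⊗-identityʳ)))))
  sort (word₁ v) = sorted 0 0 (v ∷ []) (id 0) (id 1) (≈-sym (
    ≈-trans ⨾-identityʳ (≈-trans ⨾-identityˡ
      (≈-trans (⊗-congˡ ⊗-identityˡ) (≈-trans ⊗-identityˡ ⊗-identityʳ)))))
  -- The interchange is used at two levels: on the outside it gathers the two words, and within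
  -- `sorted-⊗` it separates wires from delays.
  sort (_⊗_ {H = H} {H′} h h′)
    with sorted x y {z} us π ρ eq ← sort h | sorted x′ y′ {z′} us′ π′ ρ′ eq′ ← sort h′ =
    sorted (x + x′) (y + y′) (us ++ us′)
      ((π ⊗ π′) ⨾ mix (x + y) 0 (x′ + y′) 0 ⨾ (mix x y x′ y′ ⊗ id 0))
      ((mix x x′ y y′ ⊗ id (z + z′)) ⨾ mix (x + y) (x′ + y′) z z′ ⨾ (ρ ⊗ ρ′)) (
    H ⊗ H′
      ≈⟨ ⊗-cong eq eq′ ⟩
    (⌈ π ⌉ ⨾ (L ⊗ word us) ⨾ ⌈ ρ ⌉) ⊗ (⌈ π′ ⌉ ⨾ (L′ ⊗ word us′) ⨾ ⌈ ρ′ ⌉)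
      ≈⟨ ≈-trans interchange (⨾-congˡ interchange) ⟩
    (⌈ π ⌉ ⊗ ⌈ π′ ⌉) ⨾ ((L ⊗ word us) ⊗ (L′ ⊗ word us′)) ⨾ (⌈ ρ ⌉ ⊗ ⌈ ρ′ ⌉)
      ≈⟨ ⨾-congˡ (⨾-congʳ middle-four) ⟩
    (⌈ π ⌉ ⊗ ⌈ π′ ⌉)
      ⨾ (⌈ mix (x + y) 0 (x′ + y′) 0 ⌉ ⨾ ((L ⊗ L′) ⊗ (word us ⊗ word us′))
          ⨾ ⌈ mix (x + y) (x′ + y′) z z′ ⌉)
      ⨾ (⌈ ρ ⌉ ⊗ ⌈ ρ′ ⌉)
      ≈⟨ ⨾-congˡ (⨾-congʳ (⨾-congˡ (⨾-congʳ sorted-⊗))) ⟩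
    (⌈ π ⌉ ⊗ ⌈ π′ ⌉)
      ⨾ (⌈ mix (x + y) 0 (x′ + y′) 0 ⌉
          ⨾ ((⌈ mix x y x′ y′ ⌉ ⊗ id 0) ⨾ L+L′ ⨾ (⌈ mix x x′ y y′ ⌉ ⊗ id (z + z′)))
          ⨾ ⌈ mix (x + y) (x′ + y′) z z′ ⌉)
      ⨾ (⌈ ρ ⌉ ⊗ ⌈ ρ′ ⌉)
      ≈⟨ reassociate ⟩
    ((⌈ π ⌉ ⊗ ⌈ π′ ⌉) ⨾ ⌈ mix (x + y) 0 (x′ + y′) 0 ⌉ ⨾ (⌈ mix x y x′ y′ ⌉ ⊗ id 0))
      ⨾ L+L′
      ⨾ ((⌈ mix x x′ y y′ ⌉ ⊗ id (z + z′)) ⨾ ⌈ mix (x + y) (x′ + y′) z z′ ⌉ ⨾ (⌈ ρ ⌉ ⊗ ⌈ ρ′ ⌉)) ∎)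
    where
    L      = id x ⊗ delays y
    L′     = id x′ ⊗ delays y′
    L+L′   = (id (x + x′) ⊗ delays (y + y′)) ⊗ word (us ++ us′)

    sorted-⊗ : (L ⊗ L′) ⊗ (word us ⊗ word us′) ≈
               (⌈ mix x y x′ y′ ⌉ ⊗ id 0) ⨾ L+L′ ⨾ (⌈ mix x x′ y y′ ⌉ ⊗ id (z + z′))
    sorted-⊗ =
      (L ⊗ L′) ⊗ (word us ⊗ word us′)
        ≈⟨ ⊗-cong middle-four (≈-sym (word-++ us us′)) ⟩
      (⌈ mix x y x′ y′ ⌉ ⨾ ((id x ⊗ id x′) ⊗ (delays y ⊗ delays y′)) ⨾ ⌈ mix x x′ y y′ ⌉)
        ⊗ word (us ++ us′)
        ≈⟨ ⊗-cong (⨾-congˡ (⨾-congʳ (⊗-cong ⊗-id (≈-sym (delays-+ y y′)))))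
                  (≈-trans (≈-sym ⨾-identityʳ) (⨾-congˡ (≈-sym ⨾-identityˡ))) ⟩
      (⌈ mix x y x′ y′ ⌉ ⨾ (id (x + x′) ⊗ delays (y + y′)) ⨾ ⌈ mix x x′ y y′ ⌉)
        ⊗ (id 0 ⨾ word (us ++ us′) ⨾ id (z + z′))
        ≈⟨ ≈-trans interchange (⨾-congˡ interchange) ⟩
      (⌈ mix x y x′ y′ ⌉ ⊗ id 0) ⨾ L+L′ ⨾ (⌈ mix x x′ y y′ ⌉ ⊗ id (z + z′)) ∎

    reassociate : ∀ {a b c d e f g h} {A : SCirc a b} {B : SCirc b c} {C : SCirc c d}
                  {D : SCirc d e} {E : SCirc e f} {F : SCirc f g} {G : SCirc g h} →
                  A ⨾ (B ⨾ (C ⨾ D ⨾ E) ⨾ F) ⨾ G ≈ (A ⨾ B ⨾ C) ⨾ D ⨾ (E ⨾ F ⨾ G)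
    reassociate {A = A} {B} {C} {D} {E} {F} {G} =
      A ⨾ (B ⨾ (C ⨾ D ⨾ E) ⨾ F) ⨾ G     ≈⟨ ≈-trans (⨾-congˡ (≈-sym ⨾-assoc)) ⨾-assoc ⟩
      A ⨾ (B ⨾ (C ⨾ D ⨾ E)) ⨾ (F ⨾ G)   ≈⟨ ⨾-congˡ (≈-sym ⨾-assoc) ⟩
      A ⨾ B ⨾ (C ⨾ D ⨾ E) ⨾ (F ⨾ G)     ≈⟨ ⨾-congˡ (≈-trans (≈-sym ⨾-assoc) (⨾-congˡ (≈-sym ⨾-assoc))) ⟩
      A ⨾ B ⨾ C ⨾ D ⨾ E ⨾ (F ⨾ G)       ≈⟨ ⨾-assoc ⟩
      A ⨾ B ⨾ C ⨾ D ⨾ (E ⨾ (F ⨾ G))     ≈⟨ ⨾-congʳ ⨾-assoc ⟨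
      (A ⨾ B ⨾ C) ⨾ D ⨾ (E ⨾ F ⨾ G)     ∎

  record MealyForm {m n} (F : SCirc m n) : Set where
    constructor mealyForm
    field
      x y {z} : ℕ
      us      : Vec V z
      C       : CCirc ((x + y) + (z + m)) ((x + y) + n)
      eq      : F ≈ Tr (x + y) (((id x ⊗ delays y) ⊗ (word us ⊗ id m)) ⨾ ⌈ C ⌉)

  -- The circuit `ρ` follows the state and is absorbed by the core. The circuit `π` precedes it and
  -- has to travel round the loop by sliding, which also turns the traced object `a` into `x + y`.
  toMealyForm : ∀ {m n} (F : SCirc m n) → MealyForm F
  toMealyForm {m} {n} F
    with normal {a} {b} {H} h C eq ← normalise F
    with sorted x y {z} us π ρ eq′ ← sort h =
    mealyForm x y us (C′ ⨾ (π′ ⊗ id n)) (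
    F
      ≈⟨ eq ⟩
    Tr a ((H ⊗ id m) ⨾ ⌈ C ⌉)
      ≈⟨ Tr-cong (≈-trans (⨾-congˡ split) (≈-trans ⨾-assoc (≈-trans ⨾-assoc
           (⨾-cong (⊗-congˡ (≈-sym (castᶜ-≈ refl x+y+0))) (⨾-cong ⊗-assoc
             (≈-sym (castᶜ-≈ (ℕ.+-assoc (x + y) z m) refl))))))) ⟩
    Tr a ((⌈ π′ ⌉ ⊗ id m) ⨾ (K ⨾ ⌈ C′ ⌉))
      ≈⟨ sliding ⟨
    Tr (x + y) ((K ⨾ ⌈ C′ ⌉) ⨾ (⌈ π′ ⌉ ⊗ id n))
      ≈⟨ Tr-cong ⨾-assoc ⟩
    Tr (x + y) (K ⨾ (⌈ C′ ⌉ ⨾ (⌈ π′ ⌉ ⊗ id n))) ∎)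
    where
    x+y+0 = ℕ.+-identityʳ (x + y)
    K = (id x ⊗ delays y) ⊗ (word us ⊗ id m)
    π′ : CCirc a (x + y)
    π′ = castᶜ refl x+y+0 π
    C′ : CCirc ((x + y) + (z + m)) (a + n)
    C′ = castᶜ (ℕ.+-assoc (x + y) z m) refl ((ρ ⊗ id m) ⨾ C)
    split : H ⊗ id m ≈
            (⌈ π ⌉ ⊗ id m) ⨾ (((id x ⊗ delays y) ⊗ word us) ⊗ id m) ⨾ (⌈ ρ ⌉ ⊗ id m)
    split = ≈-trans (⊗-congˡ eq′) (≈-trans whiskerʳ-⨾ (⨾-congˡ whiskerʳ-⨾))

-- Longest chains

maximum : ∀ {p} {P : ℕ → Set p} → Unary.Decidable P → P 0 → ∀ b → (∀ e → P e → e ≤ b) →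
          ∃[ d ] P d × (∀ e → P e → e ≤ d)
maximum P? P0 zero    bounded = 0 , P0 , bounded
maximum P? P0 (suc b) bounded with P? (suc b)
... | yes Pb = suc b , Pb , bounded
... | no ¬Pb = maximum P? P0 b λ e Pe →
  ℕ.≤-pred (ℕ.≤∧≢⇒< (bounded e Pe) λ { refl → ¬Pb Pe })

increasing : ∀ {a r} {A : Set a} {R : Rel A r} → Transitive R →
             ∀ {n} (c : Fin (suc n) → A) → (∀ i → R (c (inject₁ i)) (c (suc i))) →
             ∀ {i j} → i Fin.< j → R (c i) (c j)
increasing {R = R} R-trans {suc n} c step {zero}  {suc zero}    _         = step zero
increasing {R = R} R-trans {suc n} c step {zero}  {suc (suc j)} _         =
  R-trans (step zero) (increasing {R = R} R-trans (c ∘ suc) (step ∘ suc) {zero} {suc j} (s≤s z≤n))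
increasing {R = R} R-trans {suc n} c step {suc i} {suc j}       (s≤s i<j) =
  increasing {R = R} R-trans (c ∘ suc) (step ∘ suc) i<j

module LongestChains {S : Signature} (I : Interpretation S) where
  open Signature S
  open Interpretation I
  open Denotation I using (_⊑*_; ⊥*; ⊥*-minimum; ⊑*-trans; ⊑*-antisym; ⊑*-reflexive)
  open Observation I
  private
    module L = IsLattice isLattice
    module Fi = Inverse finite

  encode : ∀ {n} → Vec V n → Fin (∣V∣ ^ n)
  encode []       = zero
  encode (v ∷ vs) = combine (Fi.to v) (encode vs)

  encode-injective : ∀ {n} {us vs : Vec V n} → encode us ≡ encode vs → us ≡ vs
  encode-injective {us = []}     {[]}     _  = refl
  encode-injective {us = u ∷ us} {v ∷ vs} eq
    with p , q ← Fin.combine-injective (Fi.to u) (encode us) (Fi.to v) (encode vs) eq =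
    cong₂ _∷_ (trans (sym (Fi.strictlyInverseʳ u)) (trans (cong Fi.from p) (Fi.strictlyInverseʳ v)))
              (encode-injective q)

  ∃V? : ∀ {p} {P : V → Set p} → Unary.Decidable P → Dec (∃ P)
  ∃V? {P = P} P? = map′ (λ (i , p) → Fi.from i , p)
                        (λ (v , p) → Fi.to v , subst P (sym (Fi.strictlyInverseʳ v)) p)
                        (Fin.any? (P? ∘ Fi.from))

  ∃Vec? : ∀ n {p} {P : Vec V n → Set p} → Unary.Decidable P → Dec (∃ P)
  ∃Vec? zero    P? = map′ (λ p → [] , p) (λ { ([] , p) → p }) (P? [])
  ∃Vec? (suc n) P? = map′ (λ (v , vs , p) → v ∷ vs , p) (λ { (v ∷ vs , p) → v , vs , p })
                          (∃V? λ v → ∃Vec? n λ vs → P? (v ∷ vs))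

  _⊑?_ : Decidable _⊑_
  v ⊑? w = map′ (λ v⊔w≡w → subst (v ⊑_) v⊔w≡w (proj₁ (L.supremum v w)))
                (λ v⊑w → L.antisym (proj₂ (proj₂ (L.supremum v w)) w v⊑w L.refl)
                                   (proj₁ (proj₂ (L.supremum v w))))
                ((v ⊔ w) ≟ w)

  _⊏*?_ : ∀ {n} → Decidable (_⊏*_ {n})
  us ⊏*? vs = Pointwise.decidable _⊑?_ us vs ×-dec ¬? (≡-dec _≟_ us vs)

  ⊏*-trans : ∀ {n} → Transitive (_⊏*_ {n})
  ⊏*-trans (us⊑vs , us≢vs) (vs⊑ws , _) =
    ⊑*-trans us⊑vs vs⊑ws ,
    λ { refl → us≢vs (⊑*-antisym us⊑vs vs⊑ws) }

  -- An inductive counterpart of `Chain` that exposes the first element, so that existence can be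
  -- decided by a finite search for the next element.
  data ChainFrom {n} (v : Vec V n) : ℕ → Set where
    []  : ChainFrom v 0
    _∷_ : ∀ {w d} → v ⊏* w → ChainFrom w d → ChainFrom v (suc d)

  chainFrom? : ∀ {n} (v : Vec V n) → Unary.Decidable (ChainFrom v)
  chainFrom? v zero    = yes []
  chainFrom? v (suc d) = map′ (λ (w , v⊏w , c) → v⊏w ∷ c) (λ { (v⊏w ∷ c) → _ , v⊏w , c })
                              (∃Vec? _ λ w → (v ⊏*? w) ×-dec chainFrom? w d)

  chainFrom⇒chain : ∀ {n d} {v : Vec V n} → ChainFrom v d → Σ (Chain n d) λ c → proj₁ c zero ≡ v
  chainFrom⇒chain {v = v} [] = ((λ _ → v) , λ ()) , refl
  chainFrom⇒chain {v = v} (v⊏w ∷ cs) with (c , step) , refl ← chainFrom⇒chain cs =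
    ((λ { zero → v ; (suc i) → c i }) , λ { zero → v⊏w ; (suc i) → step i }) , refl

  chain⇒chainFrom : ∀ {n} d ((c , _) : Chain n d) → ChainFrom (c zero) d
  chain⇒chainFrom zero    _          = []
  chain⇒chainFrom (suc d) (c , step) = step zero ∷ chain⇒chainFrom d (c ∘ suc , step ∘ suc)

  chain? : ∀ n → Unary.Decidable (Chain n)
  chain? n d = map′ (λ (v , cs) → proj₁ (chainFrom⇒chain cs)) (λ c → _ , chain⇒chainFrom d c)
                    (∃Vec? n λ v → chainFrom? v d)

  -- By the pigeonhole principle a longer chain would repeat a vector, which transitivity would
  -- place strictly below itself.
  chain-bounded : ∀ n d → Chain n d → d ≤ ∣V∣ ^ n
  chain-bounded n d (c , step) = ℕ.≮⇒≥ λ ∣Vⁿ∣<d →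
    let i , j , i<j , eq = Fin.pigeonhole (ℕ.m<n⇒m<1+n ∣Vⁿ∣<d) (encode ∘ c)
    in proj₂ (increasing {R = _⊏*_} ⊏*-trans c step i<j) (encode-injective eq)

  longestChain : ∀ n → ∃[ d ] LongestChain n d
  longestChain n = maximum (chain? n) ((λ _ → ⊥*) , λ ()) (∣V∣ ^ n) (chain-bounded n)

  module Kleene {n : ℕ} (g : Vec V n → Vec V n)
                (g-mono : ∀ {us vs} → us ⊑* vs → g us ⊑* g vs) where

    iter : ℕ → Vec V n
    iter zero    = ⊥*
    iter (suc k) = g (iter k)

    iter-ascending : ∀ k → iter k ⊑* iter (suc k)
    iter-ascending zero    = ⊥*-minimum _
    iter-ascending (suc k) = g-mono (iter-ascending k)

    iter-stable : ∀ j k → iter k ≡ iter (suc k) → iter (j + k) ≡ iter (suc (j + k))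
    iter-stable zero    k eq = eq
    iter-stable (suc j) k eq = cong g (iter-stable j k eq)

    -- Once two consecutive iterates agree, all later ones do. So if stage `d` still moved, every
    -- earlier stage would move too, and the iterates up to `suc d` would form a chain longer than
    -- the longest.
    iter-longest : ∀ {d} → LongestChain n d → iter d ≡ iter (suc d)
    iter-longest {d} (_ , longest) with ≡-dec _≟_ (iter d) (iter (suc d))
    ... | yes eq  = eq
    ... | no ¬eq = contradiction (longest (suc d) (iter ∘ toℕ , step)) ℕ.1+n≰n
      where
      distinct : ∀ k → k ≤ d → iter k ≢ iter (suc k)
      distinct k k≤d eq = ¬eq (subst (λ l → iter l ≡ iter (suc l)) (ℕ.m∸n+n≡m k≤d)
                                     (iter-stable (d ∸ k) k eq))

      step : ∀ (i : Fin (suc d)) → iter (toℕ (inject₁ i)) ⊏* iter (suc (toℕ i))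
      step i rewrite Fin.toℕ-inject₁ i =
        iter-ascending (toℕ i) , distinct (toℕ i) (Fin.toℕ≤pred[n] i)

-- Totality of productivity

module Evaluation {S : Signature} (I : Interpretation S) where
  open Signature S
  open Circuits S
  open Denotation I

  eval : ∀ {m n} → CCirc m n → Vec V m → Vec V n
  eval (gen g)           vs = act g vs
  eval (id n)            vs = vs
  eval (C ⨾ D)           vs = eval D (eval C vs)
  eval (_⊗_ {m} C D)     vs = eval C (take m vs) ++ eval D (drop m vs)
  eval (swap m n)        vs = drop m vs ++ take m vs

module Productivity {S : Signature} (I : Interpretation S) where
  open Signature S
  open Interpretation I
  open Circuits S
  open Denotation I using (act)
  open Observation I
  open TracedLaws S
  open ≈-Reasoning
  open NormalForms S
  open Evaluation I
  open LongestChains I using (longestChain)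

  infix 4 _⇝≈_ _⇝≈*_

  _⇝≈_ _⇝≈*_ : ∀ {m n} → Rel (SCirc m n) 0ℓ
  F ⇝≈ G = F ≈ G ⊎ F ⇝[ Val ] G
  _⇝≈*_ = Star _⇝≈_

  ≈⇒⇝≈* : ∀ {m n} {F G : SCirc m n} → F ≈ G → F ⇝≈* G
  ≈⇒⇝≈* F≈G = inj₁ F≈G ◅ ε

  rule⇒⇝≈* : ∀ {m n} {F G : SCirc m n} → F ▷[ Val ] G → F ⇝≈* G
  rule⇒⇝≈* r = inj₂ (rule r) ◅ ε

  ⇝≈*-⨾ˡ : ∀ {m n k} {F F′ : SCirc m n} {G : SCirc n k} → F ⇝≈* F′ → F ⨾ G ⇝≈* F′ ⨾ G
  ⇝≈*-⨾ˡ {G = G} = Star.gmap (_⨾ G) λ { (inj₁ p) → inj₁ (⨾-congˡ p) ; (inj₂ r) → inj₂ (in-⨾ˡ r) }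

  ⇝≈*-⊗ˡ : ∀ {m n k l} {F F′ : SCirc m n} {G : SCirc k l} → F ⇝≈* F′ → F ⊗ G ⇝≈* F′ ⊗ G
  ⇝≈*-⊗ˡ {G = G} = Star.gmap (_⊗ G) λ { (inj₁ p) → inj₁ (⊗-congˡ p) ; (inj₂ r) → inj₂ (in-⊗ˡ r) }

  ⇝≈*-⊗ʳ : ∀ {m n k l} {F : SCirc m n} {G G′ : SCirc k l} → G ⇝≈* G′ → F ⊗ G ⇝≈* F ⊗ G′
  ⇝≈*-⊗ʳ {F = F} = Star.gmap (F ⊗_) λ { (inj₁ p) → inj₁ (⊗-congʳ p) ; (inj₂ r) → inj₂ (in-⊗ʳ r) }

  ⇝≈*-Tr : ∀ x {m n} {F F′ : SCirc (x + m) (x + n)} → F ⇝≈* F′ → Tr x F ⇝≈* Tr x F′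
  ⇝≈*-Tr x = Star.gmap (Tr x) λ { (inj₁ p) → inj₁ (Tr-cong p) ; (inj₂ r) → inj₂ (in-Tr r) }

  -- A reduction sequence cannot begin or end modulo ≈ unless it has a step, so the
  -- ≈ steps are moved to the front, where the preceding (Str) reduction absorbs them.
  absorb-≈ : ∀ {m n} {F G : SCirc m n} → F ⇝≈* G → ∃[ F′ ] F ≈ F′ × F′ ⇝[Val]* G
  absorb-≈ ε = _ , ≈-refl , ε
  absorb-≈ (inj₁ p ◅ rs) with F′ , q , rs′ ← absorb-≈ rs = F′ , ≈-trans p q , rs′
  absorb-≈ (inj₂ r ◅ rs) with F′ , q , rs′ ← absorb-≈ rs =
    _ , ≈-refl , modulo ≈-refl r q ◅ rs′

  word-split : ∀ m {n} (vs : Vec V (m + n)) →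
               word vs ≈ word (take m vs) ⊗ word (drop m vs)
  word-split m vs = ≈-trans (≡⇒≈ (cong word (sym (take++drop≡id m vs)))) (word-++ (take m vs) (drop m vs))

  word₁-≈ : ∀ v → word (v ∷ []) ≈ value v
  word₁-≈ v = ⊗-identityʳ

  word₂-≈ : ∀ v w → word (v ∷ w ∷ []) ≈ value v ⊗ value w
  word₂-≈ v w = ⊗-congʳ ⊗-identityʳ

  -- Value rules are needed only at `prim`, `fork`, `join` and `stub`. The cases of `bot`, `id` and
  -- `swap` are consequences of the axioms; a swap after words is naturality, as words have no
  -- inputs left to permute.
  eval-⇝ : ∀ {m n} (C : CCirc m n) (vs : Vec V m) → word vs ⨾ ⌈ C ⌉ ⇝≈* word (eval C vs)
  eval-⇝ (gen (prim p)) vs = rule⇒⇝≈* (prim-v p vs)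
  eval-⇝ (gen bot) [] =
    ≈⇒⇝≈* (≈-trans ⨾-identityˡ (≈-trans (≡⇒≈ (sym value-∙)) (≈-sym (word₁-≈ ∙))))
  eval-⇝ (gen fork) (v ∷ []) =
    ≈⇒⇝≈* (⨾-congˡ (word₁-≈ v)) ◅◅ rule⇒⇝≈* (fork-v v) ◅◅ ≈⇒⇝≈* (≈-sym (word₂-≈ v v))
  eval-⇝ (gen join) (v ∷ w ∷ []) =
    ≈⇒⇝≈* (⨾-congˡ (word₂-≈ v w)) ◅◅ rule⇒⇝≈* (join-v v w) ◅◅ ≈⇒⇝≈* (≈-sym (word₁-≈ (v ⊔ w)))
  eval-⇝ (gen stub) (v ∷ []) =
    ≈⇒⇝≈* (⨾-congˡ (word₁-≈ v)) ◅◅ rule⇒⇝≈* (stub-v v)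
  eval-⇝ (id n) vs = ≈⇒⇝≈* ⨾-identityʳ
  eval-⇝ (C ⨾ D) vs =
    ≈⇒⇝≈* (≈-sym ⨾-assoc) ◅◅ ⇝≈*-⨾ˡ (eval-⇝ C vs) ◅◅ eval-⇝ D (eval C vs)
  eval-⇝ (_⊗_ {m} C D) vs =
    ≈⇒⇝≈* (≈-trans (⨾-congˡ (word-split m vs)) (≈-sym interchange))
    ◅◅ ⇝≈*-⊗ˡ (eval-⇝ C (take m vs)) ◅◅ ⇝≈*-⊗ʳ (eval-⇝ D (drop m vs))
    ◅◅ ≈⇒⇝≈* (≈-sym (word-++ (eval C (take m vs)) (eval D (drop m vs))))
  eval-⇝ (swap m n) vs = ≈⇒⇝≈* (
    word vs ⨾ swap m n                                     ≈⟨ ⨾-congˡ (word-split m vs) ⟩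
    (word (take m vs) ⊗ word (drop m vs)) ⨾ swap m n       ≈⟨ swap-natural ⟩
    swap 0 0 ⨾ (word (drop m vs) ⊗ word (take m vs))       ≈⟨ ≈-trans (⨾-congˡ (swap-0ˡ 0)) ⨾-identityˡ ⟩
    word (drop m vs) ⊗ word (take m vs)                    ≈⟨ word-++ (drop m vs) (take m vs) ⟨
    word (drop m vs ++ take m vs)                          ∎)

  -- One tick of a machine with `x` wires fed back without delay and `s` registers holding `us`. `D`
  -- is its transition function after unrolling, `us′` the next state and `ws` the output.
  module Step {x s m n d : ℕ} (C : CCirc (x + (s + m)) (x + (s + n))) (longest : LongestChain x d)
              (us : Vec V s) (vs : Vec V m) where

    D : CCirc (s + m) (s + n)
    D = unroll {x} {s + m} {s + n} C d ⨾ (stubs x ⊗ id (s + n))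

    us′ : Vec V s
    us′ = take s (eval D (us ++ vs))

    ws : Vec V n
    ws = drop s (eval D (us ++ vs))

    F₂ F₃ : SCirc m n
    F₂ = Tr s (reg (us ++ vs) ⨾ ⌈ D ⌉)
    F₃ = Tr s (((word (us ++ vs) ⨾ ⌈ D ⌉) ⊗ (⌈ D ⌉ ⨾ delays (s + n))) ⨾ ⌈ joins (s + n) ⌉)

    F′ : SCirc m n
    F′ = Tr s (⌈ D ⌉ ⨾ (reg us′ ⊗ id n))

    unrolling : reg vs ⨾ Tr s ((reg us ⊗ id m) ⨾ Tr x ⌈ C ⌉) ⇝[ IF ] F₂
    unrolling = modulo ≈-refl (in-⨾ʳ (in-Tr (in-⨾ʳ (rule (unfold {x} {n = s + n} C longest))))) (
      reg vs ⨾ Tr s ((reg us ⊗ id m) ⨾ ⌈ D ⌉)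
        ≈⟨ tightenˡ ⟩
      Tr s ((id s ⊗ reg vs) ⨾ ((reg us ⊗ id m) ⨾ ⌈ D ⌉))
        ≈⟨ Tr-cong (≈-trans (≈-sym ⨾-assoc) (⨾-congˡ
             (≈-trans (≈-sym ⊗-splitʳ) (≈-sym (reg-++ us vs))))) ⟩
      F₂ ∎)

    streaming : F₂ ⇝[ Str ] F₃
    streaming = in-Tr (rule (stream D (us ++ vs)))

    -- Once the word is evaluated, it sits beside the delays as in a register, so `D` can be moved
    -- in front of `reg (us′ ++ ws)`. The state part of that register stays in the loop; the output
    -- part leaves it by tightening.
    evaluating : F₃ ⇝≈* F′ ⨾ reg ws
    evaluating = ⇝≈*-Tr s (⇝≈*-⨾ˡ (⇝≈*-⊗ˡ (eval-⇝ D (us ++ vs)))) ◅◅ ≈⇒⇝≈* (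
      Tr s ((word (eval D (us ++ vs)) ⊗ (⌈ D ⌉ ⨾ delays (s + n))) ⨾ ⌈ joins (s + n) ⌉)
        ≈⟨ Tr-cong (⨾-congˡ (≈-trans (⊗-congˡ (≈-sym ⨾-identityˡ))
             (≈-trans interchange (⨾-congˡ ⊗-identityˡ)))) ⟩
      Tr s (⌈ D ⌉ ⨾ (word (eval D (us ++ vs)) ⊗ delays (s + n)) ⨾ ⌈ joins (s + n) ⌉)
        ≈⟨ Tr-cong (≈-trans ⨾-assoc (⨾-congʳ
             (≡⇒≈ (cong reg (sym (take++drop≡id s (eval D (us ++ vs)))))))) ⟩
      Tr s (⌈ D ⌉ ⨾ reg (us′ ++ ws))
        ≈⟨ Tr-cong (≈-trans (⨾-congʳ (≈-trans (reg-++ us′ ws) ⊗-splitˡ)) (≈-sym ⨾-assoc)) ⟩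
      Tr s (⌈ D ⌉ ⨾ (reg us′ ⊗ id n) ⨾ (id s ⊗ reg ws))
        ≈⟨ tightenʳ ⟨
      F′ ⨾ reg ws ∎)

  productive : ∀ {m n} (F : SCirc m n) (vs : Vec V m) → ∃[ F′ ] ∃[ ws ] Productive F vs F′ ws
  productive {m} {n} F vs
    with mealyForm x y {z} us C eq ← toMealyForm F
    with d , longest ← longestChain x =
    Next.F′ , Next.ws , F₁ , Next.F₂ , proj₁ evaluated ,
    modulo (⨾-congʳ eq) (in-⨾ʳ (rule (mealy x y C us))) F₁-≈ ,
    Next.unrolling ,
    modulo ≈-refl Next.streaming (proj₁ (proj₂ evaluated)) ,
    proj₂ (proj₂ evaluated)
    where
    regroup-m : ∀ m → (x + y) + (z + m) ≡ (x + (y + z)) + m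
    regroup-m = regroup x y z

    regroup-x : ∀ m → (x + y) + (z + m) ≡ x + ((y + z) + m)
    regroup-x m = trans (regroup-m m) (ℕ.+-assoc x (y + z) m)

    C₁ : CCirc ((x + y) + (z + m)) ((x + y) + (z + n))
    C₁ = C ⨾ (id (x + y) ⊗ (bots z ⊗ id n))

    C₂ : CCirc (x + ((y + z) + m)) (x + ((y + z) + n))
    C₂ = castᶜ (regroup-x m) (regroup-x n) C₁

    R : SCirc (y + z) (y + z)
    R = reg (replicate y ∙ ++ us)

    F₁ : SCirc m n
    F₁ = reg vs ⨾ Tr (y + z) ((R ⊗ id m) ⨾ Tr x ⌈ C₂ ⌉)

    -- Vanishing splits the trace into an outer loop through the registers and an inner one of width
    -- `x`; tightening moves the registers out of the inner loop, which then encloses only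
    -- combinational material, as (IF) requires.
    F₁-≈ : reg vs ⨾ Tr (x + (y + z)) (((id x ⊗ R) ⊗ id m) ⨾ cast (regroup-m m) (regroup-m n) ⌈ C₁ ⌉)
           ≈ F₁
    F₁-≈ = ⨾-congʳ (≈-trans (vanishing₊ {x} {y + z}) (Tr-cong (≈-trans (Tr-cong
      (≈-trans (cast-≈ (ℕ.+-assoc x (y + z) m) (ℕ.+-assoc x (y + z) n))
        (⨾-cong ⊗-assoc (≈-trans (cast-≈ (regroup-m m) (regroup-m n))
          (≈-sym (castᶜ-≈ (regroup-x m) (regroup-x n)))))))
      (≈-sym tightenˡ))))

    module Next = Step C₂ longest (replicate y ∙ ++ us) vs

    evaluated : ∃[ F₃ ] Next.F₃ ≈ F₃ × F₃ ⇝[Val]* Next.F′ ⨾ reg Next.ws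
    evaluated = absorb-≈ Next.evaluating

-- Soundness of the axioms

module _ {a : Level} {A : Set a} where
  open ≋ {A = A} using (_≋_)

  take-++ : ∀ {m n} (us : Vec A m) (vs : Vec A n) → take m (us ++ vs) ≡ us
  take-++ []       vs = refl
  take-++ (u ∷ us) vs = cong (u ∷_) (take-++ us vs)

  drop-++ : ∀ {m n} (us : Vec A m) (vs : Vec A n) → drop m (us ++ vs) ≡ vs
  drop-++ []       vs = refl
  drop-++ (u ∷ us) vs = drop-++ us vs

  take-≋ : ∀ m {n n′} {us : Vec A (m + n)} {vs : Vec A (m + n′)} → us ≋ vs → take m us ≋ take m vs
  take-≋ zero    ps       = []
  take-≋ (suc m) (p ∷ ps) = p ∷ take-≋ m ps

  drop-≋ : ∀ m {n n′} {us : Vec A (m + n)} {vs : Vec A (m + n′)} → us ≋ vs → drop m us ≋ drop m vs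
  drop-≋ zero    ps       = ps
  drop-≋ (suc m) (p ∷ ps) = drop-≋ m ps

  take-all : ∀ m (us : Vec A (m + 0)) → take m us ≋ us
  take-all zero    []       = []
  take-all (suc m) (u ∷ us) = refl ∷ take-all m us

  ++-[] : ∀ {m} (us : Vec A m) (vs : Vec A 0) → us ++ vs ≋ us
  ++-[] us [] = ≋.++-identityʳ us

  []-++ : ∀ {m} (us : Vec A 0) (vs : Vec A m) → us ++ vs ≡ vs
  []-++ [] vs = refl

  take-take : ∀ m {k i} {us : Vec A ((m + k) + i)} {vs : Vec A (m + (k + i))} → us ≋ vs →
              take m (take (m + k) us) ≡ take m vs
  take-take zero    ps                        = refl
  take-take (suc m) {us = _ ∷ _} {_ ∷ _} (p ∷ ps) = cong₂ _∷_ p (take-take m ps)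

  drop-take : ∀ m {k i} {us : Vec A ((m + k) + i)} {vs : Vec A (m + (k + i))} → us ≋ vs →
              drop m (take (m + k) us) ≡ take k (drop m vs)
  drop-take zero    {k} ps                    = ≋.≋⇒≡ (take-≋ k ps)
  drop-take (suc m) {us = _ ∷ _} {_ ∷ _} (p ∷ ps) = drop-take m ps

  drop-drop : ∀ m {k i} {us : Vec A ((m + k) + i)} {vs : Vec A (m + (k + i))} → us ≋ vs →
              drop (m + k) us ≡ drop k (drop m vs)
  drop-drop zero    {k} ps                    = ≋.≋⇒≡ (drop-≋ k ps)
  drop-drop (suc m) {us = _ ∷ _} {_ ∷ _} (p ∷ ps) = drop-drop m ps

-- Least fixed points and traces of stream functions

module StreamFunctions {S : Signature} (I : Interpretation S) where
  open Signature S using (V)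
  open Denotation I
  open StreamFun
  open ≋ {A = V} using (_≋_; ≋-refl; ≋-sym; ≋-trans; ≋⇒≡; ≡⇒≋)

  infix 4 _≐_ _≅_ _≡ˢ_

  _≡ˢ_ : ∀ {n} → Stream n → Stream n → Set
  σ ≡ˢ τ = ∀ t → σ t ≡ τ t

  _≐_ : ∀ {m n} → StreamFun m n → StreamFun m n → Set
  f ≐ g = ∀ σ → at f σ ≡ˢ at g σ

  ext : ∀ {m n} (f : StreamFun m n) {σ τ} → σ ≡ˢ τ → at f σ ≡ˢ at f τ
  ext f σ≡τ t = causal f t λ s _ → σ≡τ s

  monoˢ : ∀ {m n} (f : StreamFun m n) {σ τ} → σ ⊑ˢ τ → at f σ ⊑ˢ at f τ
  monoˢ f σ⊑τ t = mono f t λ s _ → σ⊑τ s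

  ⊑ˢ-reflexive : ∀ {n} {σ τ : Stream n} → σ ≡ˢ τ → σ ⊑ˢ τ
  ⊑ˢ-reflexive σ≡τ t = ⊑*-reflexive (σ≡τ t)

  ⊑ˢ-trans : ∀ {n} {σ τ υ : Stream n} → σ ⊑ˢ τ → τ ⊑ˢ υ → σ ⊑ˢ υ
  ⊑ˢ-trans σ⊑τ τ⊑υ t = ⊑*-trans (σ⊑τ t) (τ⊑υ t)

  ++ˢ-mono : ∀ {m n} {σ σ′ : Stream m} {τ τ′ : Stream n} →
             σ ⊑ˢ σ′ → τ ⊑ˢ τ′ → (σ ++ˢ τ) ⊑ˢ (σ′ ++ˢ τ′)
  ++ˢ-mono p q t = Pointwise.++⁺ (p t) (q t)

  ++ˢ-cong : ∀ {m n} {σ σ′ : Stream m} {τ τ′ : Stream n} →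
             σ ≡ˢ σ′ → τ ≡ˢ τ′ → (σ ++ˢ τ) ≡ˢ (σ′ ++ˢ τ′)
  ++ˢ-cong p q t = cong₂ _++_ (p t) (q t)

  -- Quantifying over `≋`-related pairs of inputs avoids transporting streams along equations of
  -- arities. With unequal domains `agree` would hold vacuously, hence `dom≡` is part of the data;
  -- transitivity depends on it.
  record _≅_ {m n m′ n′} (f : StreamFun m n) (g : StreamFun m′ n′) : Set where
    constructor mk≅
    field
      dom≡  : m ≡ m′
      cod≡  : n ≡ n′
      agree : ∀ {σ τ} → (∀ t → σ t ≋ τ t) → ∀ t → at f σ t ≋ at g τ t
  open _≅_

  ≐⇒≅ : ∀ {m n} {f g : StreamFun m n} → f ≐ g → f ≅ g
  ≐⇒≅ {f = f} f≐g = mk≅ refl refl λ σ≋τ t →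
    ≡⇒≋ (trans (ext f (λ s → ≋⇒≡ (σ≋τ s)) t) (f≐g _ t))

  ≅⇒≐ : ∀ {m n} {f g : StreamFun m n} → f ≅ g → f ≐ g
  ≅⇒≐ f≅g σ t = ≋⇒≡ (agree f≅g (λ _ → ≋-refl) t)

  ≅-sym : ∀ {m n m′ n′} {f : StreamFun m n} {g : StreamFun m′ n′} → f ≅ g → g ≅ f
  ≅-sym (mk≅ p q agr) = mk≅ (sym p) (sym q) λ σ≋τ t → ≋-sym (agr (λ s → ≋-sym (σ≋τ s)) t)

  ≅-trans : ∀ {m n m′ n′ m″ n″} {f : StreamFun m n} {g : StreamFun m′ n′} {h : StreamFun m″ n″} →
            f ≅ g → g ≅ h → f ≅ h
  ≅-trans (mk≅ refl q agr) (mk≅ p′ q′ agr′) =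
    mk≅ p′ (trans q q′) λ σ≋τ t → ≋-trans (agr (λ _ → ≋-refl) t) (agr′ σ≋τ t)

  ⨾ˢ-cong : ∀ {m n k m′ n′ k′} {f : StreamFun m n} {g : StreamFun n k}
            {f′ : StreamFun m′ n′} {g′ : StreamFun n′ k′} →
            f ≅ f′ → g ≅ g′ → f ⨾ˢ g ≅ f′ ⨾ˢ g′
  ⨾ˢ-cong (mk≅ p _ agr) (mk≅ _ q agr′) = mk≅ p q λ σ≋τ → agr′ (agr σ≋τ)

  ⊗ˢ-cong : ∀ {m n k l m′ n′ k′ l′} {f : StreamFun m n} {g : StreamFun k l}
            {f′ : StreamFun m′ n′} {g′ : StreamFun k′ l′} →
            f ≅ f′ → g ≅ g′ → f ⊗ˢ g ≅ f′ ⊗ˢ g′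
  ⊗ˢ-cong {m} (mk≅ refl q agr) (mk≅ p′ q′ agr′) =
    mk≅ (cong (m +_) p′) (cong₂ _+_ q q′) λ σ≋τ t →
      Pointwise.++⁺ (agr (λ s → take-≋ m (σ≋τ s)) t) (agr′ (λ s → drop-≋ m (σ≋τ s)) t)

  module _ {x : ℕ} {f : StreamFun x x} where
    open LeastFixedPoint f

    -- Park induction: every iterate stays below `τ`. Comparing the fixed points of different
    -- functions produces prefixed points, to which `μ-least` does not apply.
    μ-prefixed : ∀ {τ} → at f τ ⊑ˢ τ → μ ⊑ˢ τ
    μ-prefixed {τ} pre t = below (bound t) t
      where
      below : ∀ k → iterate k ⊑ˢ τ
      below zero    s = ⊥*-minimum _
      below (suc k)   = ⊑ˢ-trans (monoˢ f (below k)) pre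

  open LeastFixedPoint using (μ; μ-fixed; μ-least)

  μ-mono : ∀ {x} {f g : StreamFun x x} → (∀ σ → at f σ ⊑ˢ at g σ) → μ f ⊑ˢ μ g
  μ-mono {f = f} {g} f⊑g =
    μ-prefixed {f = f} (⊑ˢ-trans (f⊑g (μ g)) (⊑ˢ-reflexive (μ-fixed g)))

  μ-cong : ∀ {x} {f g : StreamFun x x} → f ≐ g → μ f ≡ˢ μ g
  μ-cong {f = f} {g} f≐g t = ⊑*-antisym
    (μ-mono {f = f} {g} (λ σ → ⊑ˢ-reflexive (f≐g σ)) t)
    (μ-mono {f = g} {f} (λ σ → ⊑ˢ-reflexive (λ s → sym (f≐g σ s))) t)

  traceˢ-cong : ∀ x {m n} {f g : StreamFun (x + m) (x + n)} → f ≐ g → traceˢ x f ≐ traceˢ x g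
  traceˢ-cong x {f = f} {g} f≐g σ t = cong (drop x) (trans
    (ext f (++ˢ-cong (μ-cong {f = feedback x f σ} {feedback x g σ}
             (λ τ s → cong (take x) (f≐g (τ ++ˢ σ) s))) (λ _ → refl)) t)
    (f≐g _ t))

  ≅-traceˢ : ∀ {x m n m′ n′} {f : StreamFun (x + m) (x + n)} {g : StreamFun (x + m′) (x + n′)} →
             m ≡ m′ → n ≡ n′ → f ≅ g → traceˢ x f ≅ traceˢ x g
  ≅-traceˢ {x} {f = f} {g} refl refl f≅g = ≐⇒≅ (traceˢ-cong x {f = f} {g} (≅⇒≐ f≅g))

  feedback-μ-cong : ∀ x {m n m′ n′} (f : StreamFun (x + m) (x + n)) (g : StreamFun (x + m′) (x + n′)) σ τ →
                 (∀ ρ t → take x (at f (ρ ++ˢ σ) t) ≡ take x (at g (ρ ++ˢ τ) t)) →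
                 μ[ x , f , σ ] ≡ˢ μ[ x , g , τ ]
  feedback-μ-cong x f g σ τ eq = μ-cong {f = feedback x f σ} {feedback x g τ} eq

  -- The rolling rule. For fixed `σ`, `h` sends the least fixed point `q` of `h` followed by `f` to
  -- a fixed point of `f` followed by `h`, so `p` is below it; conversely `f` sends `p` to a fixed
  -- point `r` above `q`, and `h` sends `r` back to `p`.
  module Sliding {x y m n : ℕ} (f : StreamFun (x + m) (y + n)) (h : StreamFun y x) (σ : Stream m) where
    lhs : StreamFun (x + m) (x + n)
    lhs = f ⨾ˢ (h ⊗ˢ idˢ n)

    rhs : StreamFun (y + m) (y + n)
    rhs = (h ⊗ˢ idˢ m) ⨾ˢ f

    p : Stream x
    p = μ[ x , lhs , σ ]

    q r : Stream y
    q = μ[ y , rhs , σ ]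
    r = take y ∘ at f (p ++ˢ σ)

    take-lhs : ∀ τ t → take x (at lhs (τ ++ˢ σ) t) ≡ at h (take y ∘ at f (τ ++ˢ σ)) t
    take-lhs τ t = take-++ (at h (take y ∘ at f (τ ++ˢ σ)) t) _

    at-rhs : ∀ τ → at rhs (τ ++ˢ σ) ≡ˢ at f (at h τ ++ˢ σ)
    at-rhs τ = ext f (++ˢ-cong (ext h λ s → take-++ (τ s) (σ s)) (λ s → drop-++ (τ s) (σ s)))

    p≡hr : at h r ≡ˢ p
    p≡hr t = trans (sym (take-lhs p t)) (μ-fixed (feedback x lhs σ) t)

    q-fixed : ∀ t → take y (at f (at h q ++ˢ σ) t) ≡ q t
    q-fixed t = trans (cong (take y) (sym (at-rhs q t))) (μ-fixed (feedback y rhs σ) t)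

    p⊑hq : p ⊑ˢ at h q
    p⊑hq = μ-least (feedback x lhs σ) (at h q) λ t →
      trans (take-lhs (at h q) t) (ext h q-fixed t)

    q⊑r : q ⊑ˢ r
    q⊑r = μ-least (feedback y rhs σ) r λ t →
      cong (take y) (trans (at-rhs r t) (ext f (++ˢ-cong p≡hr (λ _ → refl)) t))

    p≡hq : p ≡ˢ at h q
    p≡hq t = ⊑*-antisym (p⊑hq t) (⊑*-trans (monoˢ h q⊑r t) (⊑*-reflexive (p≡hr t)))

    slide : at (traceˢ x lhs) σ ≡ˢ at (traceˢ y rhs) σ
    slide t = begin
      drop x (at lhs (p ++ˢ σ) t)        ≡⟨ drop-++ (at h r t) _ ⟩
      drop y (at f (p ++ˢ σ) t)          ≡⟨ cong (drop y) (ext f (++ˢ-cong p≡hq (λ _ → refl)) t) ⟩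
      drop y (at f (at h q ++ˢ σ) t)     ≡⟨ cong (drop y) (at-rhs q t) ⟨
      drop y (at rhs (q ++ˢ σ) t)        ∎
      where open ≡-Reasoning

  -- Bekić's lemma.
  module Vanishing {x y m n : ℕ} (f : StreamFun ((x + y) + m) ((x + y) + n))
                   (g : StreamFun (x + (y + m)) (x + (y + n))) (f≅g : f ≅ g) (σ : Stream m) where

    X : Stream y → Stream x
    X β = μ[ x , g , β ++ˢ σ ]

    b : Stream y
    b = μ[ y , traceˢ x g , σ ]

    a : Stream x
    a = X b

    c : Stream (x + y)
    c = μ[ x + y , f , σ ]

    f≋g : ∀ (α : Stream x) (β : Stream y) t →
          at f ((α ++ˢ β) ++ˢ σ) t ≋ at g (α ++ˢ (β ++ˢ σ)) t
    f≋g α β = agree f≅g λ t → ≋.++-assoc (α t) (β t) (σ t)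

    ab-fixed : ∀ t → take (x + y) (at f ((a ++ˢ b) ++ˢ σ) t) ≡ (a ++ˢ b) t
    ab-fixed t = begin
      take (x + y) P                                          ≡⟨ take++drop≡id x _ ⟨
      take x (take (x + y) P) ++ drop x (take (x + y) P)      ≡⟨ cong₂ _++_ (take-take x {y} P≋Q) (drop-take x {y} P≋Q) ⟩
      take x Q ++ take y (drop x Q)                           ≡⟨ cong₂ _++_ (μ-fixed (feedback x g (b ++ˢ σ)) t)
                                                                            (μ-fixed (feedback y (traceˢ x g) σ) t) ⟩
      a t ++ b t                                              ∎
      where
      open ≡-Reasoning
      P   = at f ((a ++ˢ b) ++ˢ σ) t
      Q   = at g (a ++ˢ (b ++ˢ σ)) t
      P≋Q = f≋g a b t

    c⊑ab : c ⊑ˢ (a ++ˢ b)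
    c⊑ab = μ-least (feedback (x + y) f σ) (a ++ˢ b) ab-fixed

    c₁ : Stream x
    c₁ = take x ∘ c

    c₂ : Stream y
    c₂ = drop x ∘ c

    c₁c₂≡c : (c₁ ++ˢ c₂) ≡ˢ c
    c₁c₂≡c t = take++drop≡id x (c t)

    f-c : ∀ t → take (x + y) (at f ((c₁ ++ˢ c₂) ++ˢ σ) t) ≡ c t
    f-c t = trans (cong (take (x + y)) (ext f (++ˢ-cong c₁c₂≡c (λ _ → refl)) t))
                  (μ-fixed (feedback (x + y) f σ) t)

    c₁-fixed : ∀ t → take x (at g (c₁ ++ˢ (c₂ ++ˢ σ)) t) ≡ c₁ t
    c₁-fixed t = trans (sym (take-take x {y} (f≋g c₁ c₂ t))) (cong (take x) (f-c t))

    c₂-fixed : ∀ t → take y (drop x (at g (c₁ ++ˢ (c₂ ++ˢ σ)) t)) ≡ c₂ t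
    c₂-fixed t = trans (sym (drop-take x {y} (f≋g c₁ c₂ t))) (cong (drop x) (f-c t))

    Xc₂⊑c₁ : X c₂ ⊑ˢ c₁
    Xc₂⊑c₁ = μ-least (feedback x g (c₂ ++ˢ σ)) c₁ c₁-fixed

    -- The inner fixed point at `c₂` lies below `c₁`, so by monotonicity the outer feedback sends
    -- `c₂` to something below `c₂`. This gives a prefixed point only.
    b⊑c₂ : b ⊑ˢ c₂
    b⊑c₂ = μ-prefixed {f = feedback y (traceˢ x g) σ} λ t → ⊑*-trans
      (take-mono y (drop-mono x (monoˢ g (++ˢ-mono Xc₂⊑c₁ (λ _ → ⊑*-reflexive refl)) t)))
      (⊑*-reflexive (c₂-fixed t))

    a⊑c₁ : a ⊑ˢ c₁
    a⊑c₁ = ⊑ˢ-trans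
      (μ-mono {f = feedback x g (b ++ˢ σ)} {feedback x g (c₂ ++ˢ σ)} λ τ t →
        take-mono x (monoˢ g (++ˢ-mono {σ = τ} (λ _ → ⊑*-reflexive refl)
                                       (++ˢ-mono {τ = σ} b⊑c₂ (λ _ → ⊑*-reflexive refl))) t))
      Xc₂⊑c₁

    c≡ab : c ≡ˢ (a ++ˢ b)
    c≡ab t = ⊑*-antisym (c⊑ab t)
      (⊑*-trans (++ˢ-mono a⊑c₁ b⊑c₂ t) (⊑*-reflexive (c₁c₂≡c t)))

    vanish : at (traceˢ (x + y) f) σ ≡ˢ at (traceˢ y (traceˢ x g)) σ
    vanish t = trans (cong (drop (x + y)) (ext f (++ˢ-cong c≡ab (λ _ → refl)) t))
                     (drop-drop x {y} (f≋g a b t))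

module AxiomSoundness {S : Signature} (I : Interpretation S) where
  open Signature S
  open Circuits S
  open Denotation I
  open StreamFun
  open StreamFunctions I
  open _≅_
  open LeastFixedPoint using (μ-fixed)
  open ≋ {A = V} using (_≋_; ≋-refl; ≋-sym; ≋-trans; ≋⇒≡; ≡⇒≋)

  cast-≅ : ∀ {m n m′ n′} (p : m ≡ m′) (q : n ≡ n′) (F : SCirc m n) → ⟦ cast p q F ⟧ ≅ ⟦ F ⟧
  cast-≅ refl refl F = ≐⇒≅ λ _ _ → refl

  hexagon : ∀ m n k → ⟦ swap m (n + k) ⟧ ≐
            ⟦ cast (ℕ.+-assoc m n k) (ℕ.+-assoc n m k) (swap m n ⊗ id k)
                ⨾ cast refl (sym (ℕ.+-assoc n k m)) (id n ⊗ swap m k) ⟧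
  hexagon m n k σ t = sym (≋⇒≡ (≋-trans
    (agree (cast-≅ refl (sym (ℕ.+-assoc n k m)) (id n ⊗ swap m k)) (λ s → first s) t) second))
    where
    a : Stream m
    a = take m ∘ σ
    b : Stream n
    b = take n ∘ drop m ∘ σ
    c : Stream k
    c = drop n ∘ drop m ∘ σ

    abc≋σ : ∀ s → σ s ≋ (a s ++ b s) ++ c s
    abc≋σ s = ≋-sym (≋-trans (≋.++-assoc (a s) (b s) (c s))
      (≡⇒≋ (trans (cong (a s ++_) (take++drop≡id n (drop m (σ s)))) (take++drop≡id m (σ s)))))

    first : ∀ s → at ⟦ cast (ℕ.+-assoc m n k) (ℕ.+-assoc n m k) (swap m n ⊗ id k) ⟧ σ s ≋
                  b s ++ (a s ++ c s)
    first s = ≋-trans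
      (agree (cast-≅ (ℕ.+-assoc m n k) (ℕ.+-assoc n m k) (swap m n ⊗ id k)) abc≋σ s)
      (≋-trans (≡⇒≋ (cong₂ _++_
        (trans (cong (λ us → drop m us ++ take m us) (take-++ (a s ++ b s) (c s)))
               (cong₂ _++_ (drop-++ (a s) (b s)) (take-++ (a s) (b s))))
        (drop-++ (a s ++ b s) (c s))))
        (≋.++-assoc (b s) (a s) (c s)))

    second : at ⟦ id n ⊗ swap m k ⟧ (b ++ˢ (a ++ˢ c)) t ≋ drop m (σ t) ++ take m (σ t)
    second = ≋-trans
      (≡⇒≋ (cong₂ _++_ (take-++ (b t) (a t ++ c t))
        (trans (cong (λ us → drop m us ++ take m us) (drop-++ (b t) (a t ++ c t)))
               (cong₂ _++_ (drop-++ (a t) (c t)) (take-++ (a t) (c t))))))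
      (≋-trans (≋-sym (≋.++-assoc (b t) (c t) (a t)))
        (≡⇒≋ (cong (_++ a t) (take++drop≡id n (drop m (σ t))))))

  ⊗ˢ-assoc : ∀ {m n k l i j} (f : StreamFun m n) (g : StreamFun k l) (h : StreamFun i j) →
             (f ⊗ˢ g) ⊗ˢ h ≅ f ⊗ˢ (g ⊗ˢ h)
  ⊗ˢ-assoc {m} {n} {k} {l} {i} {j} f g h = mk≅ (ℕ.+-assoc m k i) (ℕ.+-assoc n l j) λ {σ} {τ} σ≋τ t →
    ≋-trans (≋.++-assoc (at f (take m ∘ take (m + k) ∘ σ) t) _ _)
      (≡⇒≋ (cong₂ _++_ (ext f (λ s → take-take m {k} (σ≋τ s)) t)
           (cong₂ _++_ (ext g (λ s → drop-take m {k} (σ≋τ s)) t)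
                       (ext h (λ s → drop-drop m {k} (σ≋τ s)) t))))

  -- `G` touches none of the traced wires, so both sides have the same feedback function and the
  -- same least fixed point; what remains is regrouping of vectors.
  superpose : ∀ {x m n k l} (F : SCirc (x + m) (x + n)) (G : SCirc k l) →
              ⟦ Tr x F ⊗ G ⟧ ≐ ⟦ Tr x (cast (ℕ.+-assoc x m k) (ℕ.+-assoc x n l) (F ⊗ G)) ⟧
  superpose {x} {m} {n} {k} {l} F G σ t = sym (begin
    drop x (at ⟦ FG ⟧ (ν ++ˢ σ) t)
      ≡⟨ take++drop≡id n (drop x (at ⟦ FG ⟧ (ν ++ˢ σ) t)) ⟨
    take n (drop x (at ⟦ FG ⟧ (ν ++ˢ σ) t)) ++ drop n (drop x (at ⟦ FG ⟧ (ν ++ˢ σ) t))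
      ≡⟨ cong₂ _++_ (drop-take x {n} (at-FG ν t)) (drop-drop x {n} (at-FG ν t)) ⟨
    drop x (take (x + n) (at-F⊗G ν t)) ++ drop (x + n) (at-F⊗G ν t)
      ≡⟨ cong₂ _++_ (cong (drop x) (take-++ (at ⟦ F ⟧ (ν ++ˢ σ₁) t) _))
                    (drop-++ (at ⟦ F ⟧ (ν ++ˢ σ₁) t) _) ⟩
    drop x (at ⟦ F ⟧ (ν ++ˢ σ₁) t) ++ at ⟦ G ⟧ (drop m ∘ σ) t
      ≡⟨ cong (λ us → drop x us ++ at ⟦ G ⟧ (drop m ∘ σ) t)
              (ext ⟦ F ⟧ (++ˢ-cong (feedback-μ-cong x ⟦ FG ⟧ ⟦ F ⟧ σ σ₁ same-feedback) (λ _ → refl)) t) ⟩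
    at ⟦ Tr x F ⊗ G ⟧ σ t ∎)
    where
    open ≡-Reasoning
    FG : SCirc (x + (m + k)) (x + (n + l))
    FG = cast (ℕ.+-assoc x m k) (ℕ.+-assoc x n l) (F ⊗ G)

    σ₁ : Stream m
    σ₁ = take m ∘ σ

    ν : Stream x
    ν = μ[ x , ⟦ FG ⟧ , σ ]

    at-F⊗G : Stream x → Stream ((x + n) + l)
    at-F⊗G τ t = at ⟦ F ⟧ (τ ++ˢ σ₁) t ++ at ⟦ G ⟧ (drop m ∘ σ) t

    at-FG : ∀ τ t → at-F⊗G τ t ≋ at ⟦ FG ⟧ (τ ++ˢ σ) t
    at-FG τ t = ≋-trans
      (≡⇒≋ (sym (cong₂ _++_ (ext ⟦ F ⟧ (λ s → take-++ (τ s ++ σ₁ s) _) t)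
                            (ext ⟦ G ⟧ (λ s → drop-++ (τ s ++ σ₁ s) _) t))))
      (agree (≅-sym (cast-≅ (ℕ.+-assoc x m k) (ℕ.+-assoc x n l) (F ⊗ G)))
        (λ s → ≋-trans (≋.++-assoc (τ s) (σ₁ s) (drop m (σ s)))
                       (≡⇒≋ (cong (τ s ++_) (take++drop≡id m (σ s))))) t)

    same-feedback : ∀ ρ s → take x (at ⟦ FG ⟧ (ρ ++ˢ σ) s) ≡ take x (at ⟦ F ⟧ (ρ ++ˢ σ₁) s)
    same-feedback ρ s = trans (sym (take-take x {n} (at-FG ρ s)))
                              (cong (take x) (take-++ (at ⟦ F ⟧ (ρ ++ˢ σ₁) s) _))

  -- The circuit `H` acts outside the feedback, and `F` only changes the parameter at which the
  -- fixed point is taken, from `σ` to its image.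
  tighten : ∀ {x m n m′ n′} (F : SCirc m′ m) (G : SCirc (x + m) (x + n)) (H : SCirc n n′) →
            ⟦ Tr x ((id x ⊗ F) ⨾ G ⨾ (id x ⊗ H)) ⟧ ≐ ⟦ F ⨾ Tr x G ⨾ H ⟧
  tighten {x} F G H σ t = begin
    drop x (at ⟦ FGH ⟧ (ν ++ˢ σ) t)
      ≡⟨ drop-++ (take x (at ⟦ G ⟧ (pre ν) t)) _ ⟩
    at ⟦ H ⟧ (drop x ∘ at ⟦ G ⟧ (pre ν)) t
      ≡⟨ ext ⟦ H ⟧ (λ s → cong (drop x) (ext ⟦ G ⟧ (λ r → trans (pre-≡ ν r)
           (cong (_++ at ⟦ F ⟧ σ r) (feedback-μ-cong x ⟦ FGH ⟧ ⟦ G ⟧ σ (at ⟦ F ⟧ σ) same-feedback r))) s)) t ⟩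
    at ⟦ F ⨾ Tr x G ⨾ H ⟧ σ t ∎
    where
    open ≡-Reasoning
    FGH = (id x ⊗ F) ⨾ G ⨾ (id x ⊗ H)

    ν : Stream x
    ν = μ[ x , ⟦ FGH ⟧ , σ ]

    pre : Stream x → Stream _
    pre τ = at ⟦ id x ⊗ F ⟧ (τ ++ˢ σ)

    pre-≡ : ∀ τ → pre τ ≡ˢ (τ ++ˢ at ⟦ F ⟧ σ)
    pre-≡ τ = ++ˢ-cong (λ s → take-++ (τ s) (σ s)) (ext ⟦ F ⟧ λ s → drop-++ (τ s) (σ s))

    same-feedback : ∀ ρ s → take x (at ⟦ FGH ⟧ (ρ ++ˢ σ) s) ≡ take x (at ⟦ G ⟧ (ρ ++ˢ at ⟦ F ⟧ σ) s)
    same-feedback ρ s = trans (take-++ (take x (at ⟦ G ⟧ (pre ρ) s)) _)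
                              (cong (take x) (ext ⟦ G ⟧ (pre-≡ ρ) s))

  -- The feedback function is constantly `σ`, so the fixed-point equation already determines the
  -- answer.
  yank : ∀ x → ⟦ Tr x (swap x x) ⟧ ≐ ⟦ id x ⟧
  yank x σ t = begin
    drop x (drop x (ν t ++ σ t) ++ take x (ν t ++ σ t)) ≡⟨ drop-++ (drop x (ν t ++ σ t)) _ ⟩
    take x (ν t ++ σ t)                                 ≡⟨ take-++ (ν t) (σ t) ⟩
    ν t                                                 ≡⟨ μ-fixed (feedback x (swapˢ x x) σ) t ⟨
    take x (drop x (ν t ++ σ t) ++ take x (ν t ++ σ t)) ≡⟨ take-++ (drop x (ν t ++ σ t)) _ ⟩
    drop x (ν t ++ σ t)                                 ≡⟨ drop-++ (ν t) (σ t) ⟩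
    σ t                                                 ∎
    where
    open ≡-Reasoning
    ν : Stream x
    ν = μ[ x , swapˢ x x , σ ]

  sound : ∀ {m n m′ n′} {F : SCirc m n} {G : SCirc m′ n′} → F ≈ G → ⟦ F ⟧ ≅ ⟦ G ⟧
  sound ≈-refl = ≐⇒≅ λ _ _ → refl
  sound (≈-sym p) = ≅-sym (sound p)
  sound (≈-trans p q) = ≅-trans (sound p) (sound q)
  sound (⨾-cong p q) = ⨾ˢ-cong (sound p) (sound q)
  sound (⊗-cong p q) = ⊗ˢ-cong (sound p) (sound q)
  -- The induction hypothesis equates boundaries that include the traced wires; cancelling `x` gives
  -- those of the traces.
  sound (Tr-cong {x} p) with sound p
  ... | f≅g@(mk≅ dom≡ cod≡ _) = ≅-traceˢ {x} (ℕ.+-cancelˡ-≡ x _ _ dom≡) (ℕ.+-cancelˡ-≡ x _ _ cod≡) f≅g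
  sound ⨾-identityˡ = ≐⇒≅ λ _ _ → refl
  sound ⨾-identityʳ = ≐⇒≅ λ _ _ → refl
  sound ⨾-assoc = ≐⇒≅ λ _ _ → refl
  sound (⊗-id {m}) = ≐⇒≅ λ σ t → take++drop≡id m (σ t)
  sound (interchange {m} {n} {k} {m′} {n′} {k′} {F} {G} {F′} {G′}) = ≐⇒≅ λ σ t → sym (cong₂ _++_
    (ext ⟦ G ⟧ (λ s → take-++ (at ⟦ F ⟧ (take m ∘ σ) s) (at ⟦ F′ ⟧ (drop m ∘ σ) s)) t)
    (ext ⟦ G′ ⟧ (λ s → drop-++ (at ⟦ F ⟧ (take m ∘ σ) s) (at ⟦ F′ ⟧ (drop m ∘ σ) s)) t))
  sound ⊗-identityˡ = ≐⇒≅ λ _ _ → refl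
  sound (⊗-identityʳ {m} {n} {F}) = mk≅ (ℕ.+-identityʳ m) (ℕ.+-identityʳ n) λ σ≋τ t →
    ≋-trans (++-[] _ _) (≡⇒≋ (ext ⟦ F ⟧ (λ s → ≋⇒≡ (≋-trans (take-all m _) (σ≋τ s))) t))
  sound (⊗-assoc {F = F} {G} {H}) = ⊗ˢ-assoc ⟦ F ⟧ ⟦ G ⟧ ⟦ H ⟧
  sound (swap-natural {m} {n} {m′} {n′} {F} {G}) = ≐⇒≅ λ σ t →
    let f = at ⟦ F ⟧ (take m ∘ σ) ; g = at ⟦ G ⟧ (drop m ∘ σ) in
    trans (cong₂ _++_ (drop-++ (f t) (g t)) (take-++ (f t) (g t))) (sym (cong₂ _++_
      (ext ⟦ G ⟧ (λ s → take-++ (drop m (σ s)) (take m (σ s))) t)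
      (ext ⟦ F ⟧ (λ s → drop-++ (drop m (σ s)) (take m (σ s))) t)))
  sound (swap-involutive {m} {n}) = ≐⇒≅ λ σ t →
    trans (cong₂ _++_ (drop-++ (drop m (σ t)) (take m (σ t))) (take-++ (drop m (σ t)) (take m (σ t))))
          (take++drop≡id m (σ t))
  sound (swap-hexagon {m} {n} {k}) = ≐⇒≅ (hexagon m n k)
  sound (tightening {F = F} {G} {H}) = ≐⇒≅ (tighten F G H)
  sound (sliding {F = F} {H}) = ≐⇒≅ λ σ → Sliding.slide ⟦ F ⟧ ⟦ H ⟧ σ
  sound (vanishing₀ {F = F}) = ≐⇒≅ λ σ → ext ⟦ F ⟧ λ s → []-++ _ (σ s)
  sound (vanishing₊ {x} {y} {m} {n} {F}) = ≐⇒≅ (Vanishing.vanish {x} {y} ⟦ F ⟧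
    ⟦ cast (ℕ.+-assoc x y m) (ℕ.+-assoc x y n) F ⟧
    (≅-sym (cast-≅ (ℕ.+-assoc x y m) (ℕ.+-assoc x y n) F)))
  sound (superposing {F = F} {G}) = ≐⇒≅ (superpose F G)
  sound (yanking {x}) = ≐⇒≅ (yank x)

-- Combinational circuits as functions on single ticks

module Combinational {S : Signature} (I : Interpretation S) where
  open Signature S
  open Interpretation I
  open Circuits S
  open Denotation I
  open StreamFun
  open StreamFunctions I
  open Evaluation I
  open Observation I using (unroll)
  open LongestChains I using (module Kleene)
  open ≋ {A = V} using (_≋_; ≋-refl; ≋-sym; ≋-trans; ≋⇒≡; ≡⇒≋)
  private module L = IsLattice isLattice

  boundedJoinSemilattice : BoundedJoinSemilattice 0ℓ 0ℓ 0ℓ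
  boundedJoinSemilattice = record
    { isBoundedJoinSemilattice = record
      { isJoinSemilattice = L.isJoinSemilattice ; minimum = ∙-minimum } }

  open BoundedJoinSemilatticeProperties boundedJoinSemilattice
    using () renaming (identityˡ to ⊔-identityˡ; identityʳ to ⊔-identityʳ)

  infixr 6 _⊔*_
  _⊔*_ : ∀ {n} → Vec V n → Vec V n → Vec V n
  _⊔*_ = zipWith _⊔_

  ⊔*-identityˡ : ∀ {n} (vs : Vec V n) → ⊥* ⊔* vs ≡ vs
  ⊔*-identityˡ = zipWith-identityˡ ⊔-identityˡ

  ⊔*-identityʳ : ∀ {n} (vs : Vec V n) → vs ⊔* ⊥* ≡ vs
  ⊔*-identityʳ = zipWith-identityʳ ⊔-identityʳ

  ⊥*-++ : ∀ m {n} → ⊥* {m} ++ ⊥* {n} ≡ ⊥* {m + n}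
  ⊥*-++ zero    = refl
  ⊥*-++ (suc m) = cong (∙ ∷_) (⊥*-++ m)

  take-⊥* : ∀ m {n} → take m (⊥* {m + n}) ≡ ⊥*
  take-⊥* m = trans (cong (take m) (sym (⊥*-++ m))) (take-++ ⊥* ⊥*)

  drop-⊥* : ∀ m {n} → drop m (⊥* {m + n}) ≡ ⊥*
  drop-⊥* m = trans (cong (drop m) (sym (⊥*-++ m))) (drop-++ (⊥* {m}) ⊥*)

  at-⌈⌉ : ∀ {m n} (C : CCirc m n) σ t → at ⟦ ⌈ C ⌉ ⟧ σ t ≡ eval C (σ t)
  at-⌈⌉ (gen g)    σ t = refl
  at-⌈⌉ (id n)     σ t = refl
  at-⌈⌉ (C ⨾ D)    σ t = trans (at-⌈⌉ D _ t) (cong (eval D) (at-⌈⌉ C σ t))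
  at-⌈⌉ (C ⊗ D)    σ t = cong₂ _++_ (at-⌈⌉ C _ t) (at-⌈⌉ D _ t)
  at-⌈⌉ (swap m n) σ t = refl

  eval-mono : ∀ {m n} (C : CCirc m n) {us vs} → us ⊑* vs → eval C us ⊑* eval C vs
  eval-mono (gen g)         us⊑vs = act-mono g us⊑vs
  eval-mono (id n)          us⊑vs = us⊑vs
  eval-mono (C ⨾ D)         us⊑vs = eval-mono D (eval-mono C us⊑vs)
  eval-mono (_⊗_ {m} C D)   us⊑vs =
    Pointwise.++⁺ (eval-mono C (take-mono m us⊑vs)) (eval-mono D (drop-mono m us⊑vs))
  eval-mono (swap m n)      us⊑vs = Pointwise.++⁺ (drop-mono m us⊑vs) (take-mono m us⊑vs)

  -- This is where strictness of the primitives enters. (Str) relies on it: after the first tick the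
  -- image of the word must contribute nothing to the join.
  eval-⊥* : ∀ {m n} (C : CCirc m n) → eval C ⊥* ≡ ⊥*
  eval-⊥* (gen (prim p)) = strict p
  eval-⊥* (gen bot)      = refl
  eval-⊥* (gen fork)     = refl
  eval-⊥* (gen join)     = cong (_∷ []) (⊔-identityˡ ∙)
  eval-⊥* (gen stub)     = refl
  eval-⊥* (id n)         = refl
  eval-⊥* (C ⨾ D)        = trans (cong (eval D) (eval-⊥* C)) (eval-⊥* D)
  eval-⊥* (_⊗_ {m} {n} C D) = trans
    (cong₂ _++_ (trans (cong (eval C) (take-⊥* m)) (eval-⊥* C))
                (trans (cong (eval D) (drop-⊥* m)) (eval-⊥* D)))
    (⊥*-++ n)
  eval-⊥* (swap m n)     = trans (cong₂ _++_ (drop-⊥* m) (take-⊥* m)) (⊥*-++ n)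

  eval-castᶜ : ∀ {m n m′ n′} (p : m ≡ m′) (q : n ≡ n′) (C : CCirc m n) {us vs} →
               us ≋ vs → eval (castᶜ p q C) us ≋ eval C vs
  eval-castᶜ refl refl C us≋vs = ≡⇒≋ (cong (eval C) (≋⇒≡ us≋vs))

  eval-bots : ∀ n → eval (bots n) [] ≡ ⊥*
  eval-bots zero    = refl
  eval-bots (suc n) = cong (∙ ∷_) (eval-bots n)

  eval-forks : ∀ {n} (us : Vec V n) → eval (forks n) us ≡ us ++ us
  eval-forks [] = refl
  eval-forks {suc n} (u ∷ us) = ≋⇒≡ (≋-trans
    (eval-castᶜ refl (cong suc (ℕ.+-assoc n 1 n)) (id 1 ⊗ (swap 1 n ⊗ id n))
      (≡⇒≋ (cong (λ vs → u ∷ u ∷ vs) (eval-forks us))))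
    (refl ∷ ≋-trans (≡⇒≋ (cong₂ (λ vs ws → (vs ++ u ∷ []) ++ ws) (take-++ us us) (drop-++ us us)))
                    (≋.++-assoc us (u ∷ []) us)))

  eval-joins : ∀ {n} (us vs : Vec V n) → eval (joins n) (us ++ vs) ≡ us ⊔* vs
  eval-joins [] [] = refl
  eval-joins {suc n} (u ∷ us) (v ∷ vs) = trans
    (cong (eval (gen join ⊗ joins n)) (≋⇒≡ (≋-trans
      (eval-castᶜ (cong suc (ℕ.+-assoc n 1 n)) refl (id 1 ⊗ (swap n 1 ⊗ id n))
        (refl ∷ ≋-sym (≋.++-assoc us (v ∷ []) vs)))
      (refl ∷ ≡⇒≋ (cong₂ _++_
        (trans (cong (λ ws → drop n ws ++ take n ws) (take-++ (us ++ v ∷ []) vs))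
               (cong₂ _++_ (drop-++ us (v ∷ [])) (take-++ us (v ∷ []))))
        (drop-++ (us ++ v ∷ []) vs))))))
    (cong (u ⊔ v ∷_) (eval-joins us vs))

  -- With the input frozen at one tick, the feedback is a monotone map on vectors, and `unroll C i`
  -- applies `C` once more to its `i`-th Kleene iterate.
  module Unroll {x m n : ℕ} (C : CCirc (x + m) (x + n)) (vs : Vec V m) where

    step : Vec V x → Vec V x
    step us = take x (eval C (us ++ vs))

    step-mono : ∀ {us us′} → us ⊑* us′ → step us ⊑* step us′
    step-mono us⊑us′ = take-mono x (eval-mono C (Pointwise.++⁺ us⊑us′ (⊑*-reflexive refl)))

    open Kleene step step-mono public

    eval-unroll : ∀ i → eval (unroll {x} {m} {n} C i) vs ≡ eval C (iter i ++ vs)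
    eval-unroll zero    = cong (λ us → eval C (us ++ vs)) (eval-bots x)
    eval-unroll (suc i) rewrite eval-forks vs | take-++ vs vs | drop-++ vs vs =
      cong (λ us → eval C (us ++ vs)) (≋⇒≡ (≋-trans
        (eval-castᶜ refl (ℕ.+-identityʳ x) (unroll {x} {m} {n} C i ⨾ (id x ⊗ stubs n)) ≋-refl)
        (≋-trans (++-[] _ _) (≡⇒≋ (cong (take x) (eval-unroll i))))))

-- Soundness of the reductions

module ReductionSoundness {S : Signature} (I : Interpretation S) where
  open Signature S
  open Interpretation I
  open Circuits S
  open Denotation I
  open Observation I
  open StreamFun
  open TracedLaws S
  open StreamFunctions I
  open AxiomSoundness I
  open Evaluation I
  open Combinational I
  open LeastFixedPoint using (μ-fixed; μ-least)

  infixr 5 _∷ˢ_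
  _∷ˢ_ : ∀ {n} → Vec V n → Stream n → Stream n
  (vs ∷ˢ σ) zero    = vs
  (vs ∷ˢ σ) (suc t) = σ t

  pulse : ∀ {n} → Vec V n → Stream n
  pulse vs = vs ∷ˢ λ _ → ⊥*

  pulse-++ : ∀ {m n} (us : Vec V m) (vs : Vec V n) → (pulse us ++ˢ pulse vs) ≡ˢ pulse (us ++ vs)
  pulse-++     us vs zero    = refl
  pulse-++ {m} us vs (suc t) = ⊥*-++ m

  at-value : ∀ v σ → at ⟦ value v ⟧ σ ≡ˢ pulse (v ∷ [])
  at-value v σ zero    with v ≟ ∙
  -- `act bot` matches on its empty input, so the input vector has to be split before the clause
  -- computes.
  ... | yes refl with [] ← σ 0 = refl
  ... | no _     = refl
  at-value v σ (suc t) with v ≟ ∙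
  ... | yes refl with [] ← σ (suc t) = refl
  ... | no _     = refl

  at-word : ∀ {n} (vs : Vec V n) σ → at ⟦ word vs ⟧ σ ≡ˢ pulse vs
  at-word []       σ zero    with σ 0
  ... | [] = refl
  at-word []       σ (suc t) with σ (suc t)
  ... | [] = refl
  at-word (v ∷ vs) σ t = trans (cong₂ _++_ (at-value v _ t) (at-word vs _ t)) (pulse-++ (v ∷ []) vs t)

  at-delays : ∀ n σ → at ⟦ delays n ⟧ σ ≡ˢ (⊥* ∷ˢ σ)
  at-delays zero    σ zero    with σ 0
  ... | [] = refl
  at-delays zero    σ (suc t) with σ (suc t) | σ t
  ... | [] | [] = refl
  at-delays (suc n) σ zero    = cong (∙ ∷_) (at-delays n _ zero)
  at-delays (suc n) σ (suc t) with σ t in eq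
  ... | v ∷ vs = cong (v ∷_) (trans (at-delays n _ (suc t)) (cong (drop 1) eq))

  at-joins : ∀ {n} (σ τ : Stream n) t → at ⟦ ⌈ joins n ⌉ ⟧ (σ ++ˢ τ) t ≡ σ t ⊔* τ t
  at-joins {n} σ τ t = trans (at-⌈⌉ (joins n) (σ ++ˢ τ) t) (eval-joins (σ t) (τ t))

  -- At every tick one of the joined streams is `⊥*`: the delayed one at tick 0, the word at all
  -- later ticks.
  at-reg : ∀ {n} (vs : Vec V n) σ → at ⟦ reg vs ⟧ σ ≡ˢ (vs ∷ˢ σ)
  at-reg {n} vs σ t = trans
    (trans (ext ⟦ ⌈ joins n ⌉ ⟧ (++ˢ-cong (at-word vs _) (at-delays n σ)) t)
           (at-joins (pulse vs) (⊥* ∷ˢ σ) t))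
    (joined t)
    where
    joined : ∀ t → pulse vs t ⊔* (⊥* ∷ˢ σ) t ≡ (vs ∷ˢ σ) t
    joined zero    = ⊔*-identityʳ vs
    joined (suc t) = ⊔*-identityˡ (σ t)

  ≈⇒≐ : ∀ {m n} {F G : SCirc m n} → F ≈ G → ⟦ F ⟧ ≐ ⟦ G ⟧
  ≈⇒≐ F≈G = ≅⇒≐ (sound F≈G)

  -- Sliding the bots of the right-hand side around the trace turns the register
  -- that replaced word us back into word us.
  mealy-sound : ∀ x y {z m n} (C : CCirc ((x + y) + (z + m)) ((x + y) + n)) (us : Vec V z) →
    ⟦ Tr (x + y) (((id x ⊗ delays y) ⊗ (word us ⊗ id m)) ⨾ ⌈ C ⌉) ⟧ ≐
    ⟦ Tr (x + (y + z))
         (((id x ⊗ reg (replicate y ∙ ++ us)) ⊗ id m)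
           ⨾ cast (regroup x y z m) (regroup x y z n)
                  (⌈ C ⌉ ⨾ (id (x + y) ⊗ (⌈ bots z ⌉ ⊗ id n)))) ⟧
  mealy-sound x y {z} {m} {n} C us σ t = trans
    -- Rewriting `delays y` as a register of `⊥*`, and `word us` as `bots z` followed by `reg us`,
    -- is argued on denotations, since `_≈_` has no equations for `join`. The remaining step `slid`
    -- is derived from the axioms.
    (traceˢ-cong (x + y)
      {f = ⟦ ((id x ⊗ delays y) ⊗ (word us ⊗ id m)) ⨾ ⌈ C ⌉ ⟧}
      {g = ⟦ ((id x ⊗ reg (⊥* {y})) ⊗ ((⌈ bots z ⌉ ⨾ reg us) ⊗ id m)) ⨾ ⌈ C ⌉ ⟧}
      (λ σ → ext ⟦ ⌈ C ⌉ ⟧ λ t → sym (cong₂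
        (λ us vs → (take x (take (x + y) (σ t)) ++ us) ++ (vs ++ drop (x + y) (σ t)))
        (reg-delays (drop x ∘ take (x + y) ∘ σ) t) (bots-reg (λ _ → []) t))) σ t)
    (≈⇒≐ (≈-sym slid) σ t)
    where
    open ≈-Reasoning

    reg-delays : ∀ σ → at ⟦ reg (⊥* {y}) ⟧ σ ≡ˢ at ⟦ delays y ⟧ σ
    reg-delays σ t = trans (at-reg ⊥* σ t) (sym (at-delays y σ t))

    bots-reg : ∀ σ → at ⟦ ⌈ bots z ⌉ ⨾ reg us ⟧ σ ≡ˢ at ⟦ word us ⟧ σ
    bots-reg σ t = trans (at-reg us _ t) (trans (bots-pulse t) (sym (at-word us σ t)))
      where
      bots-pulse : (us ∷ˢ at ⟦ ⌈ bots z ⌉ ⟧ σ) ≡ˢ pulse us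
      bots-pulse zero    = refl
      bots-pulse (suc t) with σ t in eq
      ... | [] = trans (at-⌈⌉ (bots z) σ t) (trans (cong (eval (bots z)) eq) (eval-bots z))

    R : SCirc (y + z) (y + z)
    R = reg (replicate y ∙ ++ us)

    B : SCirc (x + y) (x + (y + z))
    B = cast (ℕ.+-identityʳ (x + y)) (ℕ.+-assoc x y z) (id (x + y) ⊗ ⌈ bots z ⌉)

    B-≈ : B ≈ id (x + y) ⊗ ⌈ bots z ⌉
    B-≈ = cast-≈ (ℕ.+-identityʳ (x + y)) (ℕ.+-assoc x y z)

    C′ : SCirc ((x + (y + z)) + m) ((x + y) + n)
    C′ = cast (regroup x y z m) refl ⌈ C ⌉

    C′-≈ : C′ ≈ ⌈ C ⌉
    C′-≈ = cast-≈ (regroup x y z m) refl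

    B-R : (B ⊗ id m) ⨾ ((id x ⊗ R) ⊗ id m) ≈
          (id x ⊗ reg (⊥* {y})) ⊗ ((⌈ bots z ⌉ ⨾ reg us) ⊗ id m)
    B-R =
      (B ⊗ id m) ⨾ ((id x ⊗ R) ⊗ id m)
        ≈⟨ whiskerʳ-⨾ ⟨
      (B ⨾ (id x ⊗ R)) ⊗ id m
        ≈⟨ ⊗-congˡ (⨾-cong B-≈ (≈-trans (⊗-congʳ (reg-++ ⊥* us)) (≈-sym ⊗-assoc))) ⟩
      ((id (x + y) ⊗ ⌈ bots z ⌉) ⨾ ((id x ⊗ reg (⊥* {y})) ⊗ reg us)) ⊗ id m
        ≈⟨ ⊗-congˡ (≈-trans (≈-sym interchange) (⊗-congˡ ⨾-identityˡ)) ⟩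
      ((id x ⊗ reg (⊥* {y})) ⊗ (⌈ bots z ⌉ ⨾ reg us)) ⊗ id m
        ≈⟨ ⊗-assoc ⟩
      (id x ⊗ reg (⊥* {y})) ⊗ ((⌈ bots z ⌉ ⨾ reg us) ⊗ id m) ∎

    slid : Tr (x + (y + z))
             (((id x ⊗ R) ⊗ id m)
               ⨾ cast (regroup x y z m) (regroup x y z n)
                      (⌈ C ⌉ ⨾ (id (x + y) ⊗ (⌈ bots z ⌉ ⊗ id n)))) ≈
           Tr (x + y) (((id x ⊗ reg (⊥* {y})) ⊗ ((⌈ bots z ⌉ ⨾ reg us) ⊗ id m)) ⨾ ⌈ C ⌉)
    slid =
      Tr (x + (y + z)) (((id x ⊗ R) ⊗ id m) ⨾ cast (regroup x y z m) (regroup x y z n)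
        (⌈ C ⌉ ⨾ (id (x + y) ⊗ (⌈ bots z ⌉ ⊗ id n))))
        ≈⟨ Tr-cong (≈-trans (⨾-congʳ (≈-trans (cast-≈ (regroup x y z m) (regroup x y z n))
             (⨾-cong (≈-sym C′-≈) (≈-trans (≈-sym ⊗-assoc) (⊗-congˡ (≈-sym B-≈)))))) (≈-sym ⨾-assoc)) ⟩
      Tr (x + (y + z)) (((id x ⊗ R) ⊗ id m) ⨾ C′ ⨾ (B ⊗ id n))
        ≈⟨ sliding ⟩
      Tr (x + y) ((B ⊗ id m) ⨾ (((id x ⊗ R) ⊗ id m) ⨾ C′))
        ≈⟨ Tr-cong (≈-trans (≈-sym ⨾-assoc) (⨾-cong B-R C′-≈)) ⟩
      Tr (x + y) (((id x ⊗ reg (⊥* {y})) ⊗ ((⌈ bots z ⌉ ⨾ reg us) ⊗ id m)) ⨾ ⌈ C ⌉) ∎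

  -- A combinational loop has no memory, so its fixed point on streams can be computed tick by tick.
  -- Every iterate lies below `ν` by induction; the `d`-th iterates are stationary at each tick, so
  -- they form a fixed point and lie above `ν`.
  unfold-sound : ∀ {x m n d} (C : CCirc (x + m) (x + n)) → LongestChain x d →
    ⟦ Tr x ⌈ C ⌉ ⟧ ≐ ⟦ ⌈ unroll C d ⌉ ⨾ (⌈ stubs x ⌉ ⊗ id n) ⟧
  unfold-sound {x} {m} {n} {d} C longest σ t = begin
    drop x (at ⟦ ⌈ C ⌉ ⟧ (ν ++ˢ σ) t)
      ≡⟨ cong (drop x) (at-⌈⌉ C (ν ++ˢ σ) t) ⟩
    drop x (eval C (ν t ++ σ t))
      ≡⟨ cong (λ us → drop x (eval C (us ++ σ t))) ν≡iter ⟩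
    drop x (eval C (U.iter t d ++ σ t))
      ≡⟨ cong (drop x) (trans (at-⌈⌉ (unroll C d) σ t) (U.eval-unroll t d)) ⟨
    drop x (at ⟦ ⌈ unroll C d ⌉ ⟧ σ t)
      ≡⟨ []-++ _ _ ⟨
    at ⟦ ⌈ unroll C d ⌉ ⨾ (⌈ stubs x ⌉ ⊗ id n) ⟧ σ t ∎
    where
    open ≡-Reasoning
    module U (t : ℕ) = Unroll {x} {m} {n} C (σ t)

    f : StreamFun x x
    f = feedback x ⟦ ⌈ C ⌉ ⟧ σ

    ν : Stream x
    ν = μ[ x , ⟦ ⌈ C ⌉ ⟧ , σ ]

    at-f : ∀ τ t → at f τ t ≡ U.step t (τ t)
    at-f τ t = cong (take x) (at-⌈⌉ C (τ ++ˢ σ) t)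

    iter⊑ν : ∀ k → U.iter t k ⊑* ν t
    iter⊑ν zero    = ⊥*-minimum _
    iter⊑ν (suc k) = ⊑*-trans (U.step-mono t (iter⊑ν k))
      (⊑*-reflexive (trans (sym (at-f ν t)) (μ-fixed f t)))

    ν⊑iter : ν ⊑ˢ λ s → U.iter s d
    ν⊑iter = μ-least f (λ s → U.iter s d) λ s → trans (at-f _ s) (sym (U.iter-longest s longest))

    ν≡iter : ν t ≡ U.iter t d
    ν≡iter = ⊑*-antisym (ν⊑iter t) (iter⊑ν d)

  -- `C` distributes over this particular join although it need not preserve joins in general: the
  -- delayed stream is `⊥*` at tick 0, and the image of the pulse is `⊥*` afterwards.
  stream-sound : ∀ {a b} (C : CCirc a b) (us : Vec V a) →
    ⟦ reg us ⨾ ⌈ C ⌉ ⟧ ≐ ⟦ ((word us ⨾ ⌈ C ⌉) ⊗ (⌈ C ⌉ ⨾ delays b)) ⨾ ⌈ joins b ⌉ ⟧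
  stream-sound {a} {b} C us σ t = begin
    at ⟦ ⌈ C ⌉ ⟧ (at ⟦ reg us ⟧ σ) t
      ≡⟨ at-⌈⌉ C _ t ⟩
    eval C (at ⟦ reg us ⟧ σ t)
      ≡⟨ cong (eval C) (at-reg us σ t) ⟩
    eval C ((us ∷ˢ σ) t)
      ≡⟨ joined t ⟨
    eval C (pulse us t) ⊔* (⊥* ∷ˢ at ⟦ ⌈ C ⌉ ⟧ σ) t
      ≡⟨ at-joins (λ s → eval C (pulse us s)) (⊥* ∷ˢ at ⟦ ⌈ C ⌉ ⟧ σ) t ⟨
    at ⟦ ⌈ joins b ⌉ ⟧ ((λ s → eval C (pulse us s)) ++ˢ (⊥* ∷ˢ at ⟦ ⌈ C ⌉ ⟧ σ)) t
      ≡⟨ ext ⟦ ⌈ joins b ⌉ ⟧ (++ˢ-cong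
           (λ s → trans (at-⌈⌉ C _ s) (cong (eval C) (at-word us _ s)))
           (at-delays b (at ⟦ ⌈ C ⌉ ⟧ σ))) t ⟨
    at ⟦ ((word us ⨾ ⌈ C ⌉) ⊗ (⌈ C ⌉ ⨾ delays b)) ⨾ ⌈ joins b ⌉ ⟧ σ t ∎
    where
    open ≡-Reasoning
    joined : ∀ t → eval C (pulse us t) ⊔* (⊥* ∷ˢ at ⟦ ⌈ C ⌉ ⟧ σ) t ≡ eval C ((us ∷ˢ σ) t)
    joined zero    = ⊔*-identityʳ _
    joined (suc t) = trans (cong₂ _⊔*_ (eval-⊥* C) (at-⌈⌉ C σ t)) (⊔*-identityˡ _)

  rule-sound : ∀ {m n k} {F G : SCirc m n} → F ▷[ k ] G → ⟦ F ⟧ ≐ ⟦ G ⟧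
  rule-sound (mealy x y C us) = mealy-sound x y C us
  rule-sound (unfold C longest) = unfold-sound C longest
  rule-sound (stream C us) = stream-sound C us
  -- On an input of arity 0, the left factor of a tensor receives `take 0`, the constant stream
  -- `λ _ → []`, and the right factor receives `σ` itself; hence the two instances of `at-value`.
  rule-sound (fork-v v) σ t
    rewrite at-value v σ t | at-value v (λ _ → []) t with t
  ... | zero  = refl
  ... | suc _ = refl
  rule-sound (join-v v w) σ t
    rewrite at-value v (λ _ → []) t | at-value w σ t | at-value (v ⊔ w) σ t
    with t
  ... | zero  = refl
  ... | suc _ = eval-⊥* (gen join)
  rule-sound (stub-v v) σ t rewrite at-value v σ t with t | σ t
  ... | zero  | [] = refl
  ... | suc _ | [] = refl
  rule-sound (prim-v p vs) σ t rewrite at-word vs σ t | at-word (⟦ p ⟧ᵖ vs) σ t with t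
  ... | zero  = refl
  ... | suc _ = strict p

  ⇝-sound : ∀ {m n k} {F G : SCirc m n} → F ⇝[ k ] G → ⟦ F ⟧ ≐ ⟦ G ⟧
  ⇝-sound (rule r) = rule-sound r
  ⇝-sound (modulo {F = F} {F′} {G} {G′} p r q) σ t =
    trans (≈⇒≐ p σ t) (trans (⇝-sound r σ t) (≈⇒≐ q σ t))
  ⇝-sound (in-⨾ˡ {G = G} r) σ = ext ⟦ G ⟧ (⇝-sound r σ)
  ⇝-sound (in-⨾ʳ r) σ = ⇝-sound r _
  ⇝-sound (in-⊗ˡ {m = m} {G = G} r) σ t = cong (_++ at ⟦ G ⟧ (drop m ∘ σ) t) (⇝-sound r (take m ∘ σ) t)
  ⇝-sound (in-⊗ʳ {m = m} {F = F} r) σ t = cong (at ⟦ F ⟧ (take m ∘ σ) t ++_) (⇝-sound r (drop m ∘ σ) t)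
  ⇝-sound (in-Tr {x} {F = F} {F′} r) = traceˢ-cong x {f = ⟦ F ⟧} {⟦ F′ ⟧} (⇝-sound r)

  ⇝*-sound : ∀ {m n} {F G : SCirc m n} → F ⇝[Val]* G → ⟦ F ⟧ ≐ ⟦ G ⟧
  ⇝*-sound ε        σ t = refl
  ⇝*-sound (r ◅ rs) σ t = trans (⇝-sound r σ t) (⇝*-sound rs σ t)

  productive-sound : ∀ {m n} {F F′ : SCirc m n} {vs ws} → Productive F vs F′ ws →
                     ∀ σ → at ⟦ F ⟧ (vs ∷ˢ σ) ≡ˢ (ws ∷ˢ at ⟦ F′ ⟧ σ)
  productive-sound {F = F} {F′} {vs} {ws} (_ , _ , _ , r₁ , r₂ , r₃ , rs) σ t = begin
    at ⟦ F ⟧ (vs ∷ˢ σ) t          ≡⟨ ext ⟦ F ⟧ (at-reg vs σ) t ⟨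
    at ⟦ reg vs ⨾ F ⟧ σ t         ≡⟨ ⇝-sound r₁ σ t ⟩
    _                             ≡⟨ ⇝-sound r₂ σ t ⟩
    _                             ≡⟨ ⇝-sound r₃ σ t ⟩
    _                             ≡⟨ ⇝*-sound rs σ t ⟩
    at ⟦ F′ ⨾ reg ws ⟧ σ t        ≡⟨ at-reg ws (at ⟦ F′ ⟧ σ) t ⟩
    (ws ∷ˢ at ⟦ F′ ⟧ σ) t         ∎
    where open ≡-Reasoning

-- Observational equivalence

m<2^m : ∀ m → m < 2 ^ m
m<2^m zero    = s≤s z≤n
m<2^m (suc m) = ℕ.+-mono-≤ (ℕ.m^n>0 2 m) (ℕ.≤-trans (m<2^m m) (ℕ.m≤m+n (2 ^ m) 0))

Fin-subsingleton : ∀ {n} → n < 2 → (i j : Fin n) → i ≡ j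
Fin-subsingleton {1} _               zero zero = refl
Fin-subsingleton {suc (suc _)} (s<s (s<s ()))

module ObservationalEquivalence {S : Signature} (I : Interpretation S) where
  open Signature S
  open Circuits S
  open Denotation I
  open StreamFun
  open Observation I
  open StreamFunctions I
  open Productivity I
  open ReductionSoundness I
  private module Fi = Inverse finite

  prepend : ∀ {m k} → Vec (Vec V m) k → Stream m → Stream m
  prepend []         σ = σ
  prepend (vs ∷ vss) σ = vs ∷ˢ prepend vss σ

  prepend-prefix : ∀ {m} k (σ : Stream m) →
                   prepend (tabulate {n = k} (σ ∘ toℕ)) (σ ∘ (k +_)) ≡ˢ σ
  prepend-prefix zero    σ t       = refl
  prepend-prefix (suc k) σ zero    = refl
  prepend-prefix (suc k) σ (suc t) = prepend-prefix k (σ ∘ suc) t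

  waveform-exists : ∀ {m n k} (F : SCirc m n) (vss : Vec (Vec V m) k) → ∃[ wss ] Waveform F vss wss
  waveform-exists F []         = [] , []
  waveform-exists F (vs ∷ vss) =
    let F′ , ws , p = productive F vs
        wss , ps    = waveform-exists F′ vss
    in ws ∷ wss , p ∷ ps

  waveform-sound : ∀ {m n k} {F : SCirc m n} {vss : Vec (Vec V m) k} {wss} → Waveform F vss wss →
                   ∀ σ i → at ⟦ F ⟧ (prepend vss σ) (toℕ i) ≡ lookup wss i
  waveform-sound (p ∷ ps) σ zero    = productive-sound p _ zero
  waveform-sound (p ∷ ps) σ (suc i) =
    trans (productive-sound p _ (suc (toℕ i))) (waveform-sound ps σ i)

  -- The reductions of `F` are not replayed in `G`. Totality gives some waveform of `G`, and
  -- soundness forces its output to agree with that of `F` at every index.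
  waveform-resp-≐ : ∀ {m n k} {F G : SCirc m n} {vss : Vec (Vec V m) k} {wss} →
                    ⟦ F ⟧ ≐ ⟦ G ⟧ → Waveform F vss wss → Waveform G vss wss
  waveform-resp-≐ {F = F} {G} {vss} {wss} F≐G w with wss′ , w′ ← waveform-exists G vss =
    subst (Waveform G vss) (begin
      wss′                    ≡⟨ tabulate∘lookup wss′ ⟨
      tabulate (lookup wss′)  ≡⟨ tabulate-cong (λ i → trans (sym (waveform-sound w′ σ i))
                                  (trans (sym (F≐G (prepend vss σ) (toℕ i))) (waveform-sound w σ i))) ⟩
      tabulate (lookup wss)   ≡⟨ tabulate∘lookup wss ⟩
      wss                     ∎) w′
    where
    open ≡-Reasoning
    -- Soundness speaks of infinite inputs; any continuation of `vss` would serve.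
    σ : Stream _
    σ _ = ⊥*

  ≐⇒∼ : ∀ {m n} {F G : SCirc m n} → ⟦ F ⟧ ≐ ⟦ G ⟧ → F ∼ G
  ≐⇒∼ F≐G c _ _ vss wss =
    mk⇔ (waveform-resp-≐ F≐G) (waveform-resp-≐ λ σ t → sym (F≐G σ t))

  -- The degenerate case of the next argument: with a single value the waveforms compared by `_∼_`
  -- have length 2 for every `c` and cannot reach late ticks, but then all outputs coincide anyway.
  V-subsingleton : ∣V∣ < 2 → (v w : V) → v ≡ w
  V-subsingleton ∣V∣<2 v w = begin
    v                 ≡⟨ Fi.strictlyInverseʳ v ⟨
    Fi.from (Fi.to v) ≡⟨ cong Fi.from (Fin-subsingleton ∣V∣<2 (Fi.to v) (Fi.to w)) ⟩
    Fi.from (Fi.to w) ≡⟨ Fi.strictlyInverseʳ w ⟩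
    w                 ∎
    where open ≡-Reasoning

  Vec-subsingleton : ∣V∣ < 2 → ∀ {n} (us vs : Vec V n) → us ≡ vs
  Vec-subsingleton ∣V∣<2 []       []       = refl
  Vec-subsingleton ∣V∣<2 (u ∷ us) (v ∷ vs) =
    cong₂ _∷_ (V-subsingleton ∣V∣<2 u v) (Vec-subsingleton ∣V∣<2 us vs)

  -- With at least two values, waveforms of length ∣V∣ ^ c + 1 reach time t once c ≥ t.
  ∼⇒≐ : ∀ {m n} {F G : SCirc m n} → F ∼ G → ⟦ F ⟧ ≐ ⟦ G ⟧
  ∼⇒≐ {F = F} {G} F∼G σ t with ∣V∣ ℕ.<? 2
  ... | yes ∣V∣<2 = Vec-subsingleton ∣V∣<2 _ _
  ... | no  ∣V∣≮2 = begin
    at ⟦ F ⟧ σ t             ≡⟨ at-lookup F w ⟩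
    lookup wss i             ≡⟨ at-lookup G (Equivalence.to (F∼G c #F≤c #G≤c vss wss) w) ⟨
    at ⟦ G ⟧ σ t             ∎
    where
    open ≡-Reasoning
    c k : ℕ
    -- One number that is admissible for both circuits and at least `t`.
    c = #delays F + #delays G + t
    k = ∣V∣ ^ c + 1

    #F≤c : #delays F ≤ c
    #F≤c = ℕ.m≤n⇒m≤n+o t (ℕ.m≤m+n (#delays F) (#delays G))

    #G≤c : #delays G ≤ c
    #G≤c = ℕ.m≤n⇒m≤n+o t (ℕ.m≤n+m (#delays G) (#delays F))

    t<k : t < k
    t<k = ℕ.m≤n⇒m≤n+o 1 (ℕ.≤-trans (ℕ.≤-<-trans (ℕ.m≤n+m t (#delays F + #delays G)) (m<2^m c))
                                   (ℕ.^-monoˡ-≤ c (ℕ.≮⇒≥ ∣V∣≮2)))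

    i : Fin k
    i = fromℕ< t<k

    vss : Vec (Vec V _) k
    vss = tabulate (σ ∘ toℕ)

    wss : Vec (Vec V _) k
    wss = proj₁ (waveform-exists F vss)

    w : Waveform F vss wss
    w = proj₂ (waveform-exists F vss)

    at-lookup : ∀ H → Waveform H vss wss → at ⟦ H ⟧ σ t ≡ lookup wss i
    at-lookup H w′ = begin
      at ⟦ H ⟧ σ t
        ≡⟨ ext ⟦ H ⟧ (prepend-prefix k σ) t ⟨
      at ⟦ H ⟧ (prepend vss (σ ∘ (k +_))) t
        ≡⟨ cong (at ⟦ H ⟧ (prepend vss (σ ∘ (k +_)))) (Fin.toℕ-fromℕ< t<k) ⟨
      at ⟦ H ⟧ (prepend vss (σ ∘ (k +_))) (toℕ i)
        ≡⟨ waveform-sound w′ (σ ∘ (k +_)) i ⟩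
      lookup wss i ∎

  ∼-isCongruence : IsCongruence _∼_
  ∼-isCongruence = record
    { isEquivalence = record
      { refl  = ≐⇒∼ λ _ _ → refl
      ; sym   = λ p → ≐⇒∼ λ σ t → sym (∼⇒≐ p σ t)
      -- A bound on the delays of the outer circuits need not bound those of the middle one, so the
      -- two equivalences cannot be chained at a fixed `c`; the denotation does not depend on `c`.
      ; trans = λ p q → ≐⇒∼ λ σ t → trans (∼⇒≐ p σ t) (∼⇒≐ q σ t)
      }
    ; ≈⇒R          = λ p → ≐⇒∼ (≈⇒≐ p)
    ; ⨾-preserves  = λ {G = G} p q → ≐⇒∼ λ σ t → trans (ext ⟦ G ⟧ (∼⇒≐ p σ) t) (∼⇒≐ q _ t)
    ; ⊗-preserves  = λ p q → ≐⇒∼ λ σ t → cong₂ _++_ (∼⇒≐ p _ t) (∼⇒≐ q _ t)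
    ; Tr-preserves = λ x {F = F} {F′} p → ≐⇒∼ (traceˢ-cong x {f = ⟦ F ⟧} {⟦ F′ ⟧} (∼⇒≐ p))
    }

corollary4p34 : ∀ {ℓ} (S : Signature) (I : Interpretation S) →
    let open Circuits S
        open Denotation I
        open Observation I
    in IsCongruence _∼_
       × Adequate _∼_
       × (∀ (R : CircRel ℓ) → IsCongruence R → Adequate R →
          ∀ {m n} {F G : SCirc m n} → R F G → F ∼ G)
corollary4p34 S I = ∼-isCongruence , ∼⇒≐ , λ R _ R-adequate r → ≐⇒∼ (R-adequate r)
  where open ObservationalEquivalence I
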